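{- Let $t$ be a term such that $t\to_h^{(b,e,m)}u$ with $u\in\mathcal{M}$ (a head-reduction sequence with exactly $b$ steps of kind (b), $e$ steps of kind (e) and $m$ steps of kind (m)). Then there exists a tight derivation $\Phi\triangleright\Gamma\vdash^{(b,e,m,|u|)}t:\mathtt{t}$ in system $\mathscr{E}$, for some context $\Gamma$ and tight type $\mathtt{t}$.
   Context: Pair pattern calculus: patterns $p,q ::= x\mid\langle p,q\rangle$ (linear); $\mathrm{var}(p)$ = variables of $p$; $p\# q$ means disjoint variables. Terms $t,u ::= x\mid\lambda p.t\mid\langle t,u\rangle\mid t\,u\mid t[p/u]$, $\mathrm{var}(p)$ bound in $t$ in $\lambda p.t$ and $t[p/u]$; $\mathrm{fv}$ as usual; terms modulo $\alpha$. List contexts $L::=\Box\mid L[p/u]$, $L\langle t\rangle$ plugging (possibly capturing), $\mathrm{bv}(L)$ variables bound by $L$; $t\{x/u\}$ capture-avoiding substitution; $\mathrm{abs}(t)$ iff $t=L\langle\lambda p.u\rangle$. Head reduction ($t\not\to_h$: no $u$ with $t\to_h u$): (b) $L\langle\lambda p.t\rangle u\to_h L\langle t[p/u]\rangle$ if $\mathrm{bv}(L)\cap\mathrm{fv}(u)=\emptyset$; (m) $t[\langle p_1,p_2\rangle/L\langle\langle u_1,u_2\rangle\rangle]\to_h L\langle t[p_1/u_1][p_2/u_2]\rangle$ if $t\not\to_h$ and $\mathrm{bv}(L)\cap\mathrm{fv}(t)=\emptyset$; (e) $t[x/u]\to_h t\{x/u\}$ if $t\not\to_h$; closure: $\lambda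 p.t\to_h\lambda p.t'$ if $t\to_h t'$; $tu\to_h t'u$ if $t\to_h t'$ and not $\mathrm{abs}(t)$; $t[p/u]\to_h t'[p/u]$ if $t\to_h t'$; $t[p/u]\to_h t[p/u']$ if $t\not\to_h$, $p$ not a variable, $u\to_h u'$. The kind of a step is the base rule (b), (e) or (m) it uses. Canonical forms $\mathcal{M} ::= \lambda p.\mathcal{M}\mid\langle t,t\rangle\mid\mathcal{M}[\langle p_1,p_2\rangle/\mathcal{N}]\mid\mathcal{N}$, $\mathcal{N} ::= x\mid\mathcal{N}\,t\mid\mathcal{N}[\langle p_1,p_2\rangle/\mathcal{N}]$, with size $|x|=0$, $|\langle t,u\rangle|=1$, $|\mathcal{N}t|=|\mathcal{N}|+1$, $|\lambda p.\mathcal{M}|=|\mathcal{M}|+1$, $|\mathcal{M}[\langle p_1,p_2\rangle/\mathcal{N}]|=|\mathcal{M}|+|\mathcal{N}|+1$. System $\mathscr{E}$. Types: tight types $\mathtt{t} ::= \bullet_{\mathcal{N}}\mid\bullet_{\mathcal{M}}$; types $\sigma ::= \mathtt{t}\mid \mathcal{A}_1\times\mathcal{A}_2\mid \mathcal{A}\to\sigma$; multi-types $\mathcal{A} ::= [\sigma_k]_{k\in K}$ (finite, possibly empty). Contexts map variables to multi-types, $\mathrm{dom}(\Gamma)$ = variables with non-empty multi-type; $\wedge$ pointwise multiset union; $\Gamma|_p$ restriction to $\mathrm{var}(p)$; $\Gamma\setminus\mathrm{var}(p)$ removal. $\mathrm{tight}(\sigma)$ iff $\sigma\in\{\bullet_{\mathcal{N}},\bullet_{\mathcal{M}}\}$,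 extended elementwise. Rules: (pat_v) $x:\mathcal{A}\Vdash^{(1,0,0)} x:\mathcal{A}$. (pat_×) from $\Gamma\Vdash^{(e_p,m_p,f_p)}p:\mathcal{A}$, $\Delta\Vdash^{(e_q,m_q,f_q)}q:\mathcal{B}$, $p\#q$ infer $\Gamma\wedge\Delta\Vdash^{(e_p+e_q,1+m_p+m_q,f_p+f_q)}\langle p,q\rangle:[\mathcal{A}\times\mathcal{B}]$. (pat_p) if $\mathrm{dom}(\Gamma)\subseteq\mathrm{var}(\langle p,q\rangle)$ and $\mathrm{tight}(\Gamma)$ then $\Gamma\Vdash^{(0,0,1)}\langle p,q\rangle:[\bullet_{\mathcal{N}}]$. (ax) $x:[\sigma]\vdash^{(0,0,0,0)}x:\sigma$. (abs) from $\Gamma\vdash^{(b,e,m,f)}t:\sigma$ and $\Gamma|_p\Vdash^{(e_p,m_p,f_p)}p:\mathcal{A}$ infer $\Gamma\setminus\mathrm{var}(p)\vdash^{(b+1,e+e_p,m+m_p,f+f_p)}\lambda p.t:\mathcal{A}\to\sigma$. (abs_p) from $\Gamma\vdash^{(b,e,m,f)}t:\mathtt{t}$ ($\mathtt{t}$ tight) and $\mathrm{tight}(\Gamma|_p)$ infer $\Gamma\setminus\mathrm{var}(p)\vdash^{(b,e,m,f+1)}\lambda p.t:\bullet_{\mathcal{M}}$. (many) from $(\Gamma_k\vdash^{(b_k,e_k,m_k,f_k)}t:\sigma_k)_{k\in K}$ infer $\wedge_k\Gamma_k\vdash^{(\sum b_k,\sum e_k,\sum m_k,\sum f_k)}t:[\sigma_k]_{k\in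 K}$. (app) from $\Gamma\vdash^{(b_t,e_t,m_t,f_t)}t:\mathcal{A}\to\sigma$, $\Delta\vdash^{(b_u,e_u,m_u,f_u)}u:\mathcal{A}$ infer $\Gamma\wedge\Delta\vdash^{(b_t+b_u,e_t+e_u,m_t+m_u,f_t+f_u)}t\,u:\sigma$. (app_p) from $\Gamma\vdash^{(b,e,m,f)}t:\bullet_{\mathcal{N}}$ infer $\Gamma\vdash^{(b,e,m,f+1)}t\,u:\bullet_{\mathcal{N}}$. (pair) from $\Gamma\vdash^{(b_t,e_t,m_t,f_t)}t:\mathcal{A}$, $\Delta\vdash^{(b_u,e_u,m_u,f_u)}u:\mathcal{B}$ infer $\Gamma\wedge\Delta\vdash^{(b_t+b_u,e_t+e_u,m_t+m_u,f_t+f_u)}\langle t,u\rangle:\mathcal{A}\times\mathcal{B}$. (pair_p) $\vdash^{(0,0,0,1)}\langle t,u\rangle:\bullet_{\mathcal{M}}$. (match) from $\Gamma\vdash^{(b_t,e_t,m_t,f_t)}t:\sigma$, $\Gamma|_p\Vdash^{(e_p,m_p,f_p)}p:\mathcal{A}$, $\Delta\vdash^{(b_u,e_u,m_u,f_u)}u:\mathcal{A}$ infer $(\Gamma\setminus\mathrm{var}(p))\wedge\Delta\vdash^{(b_t+b_u,e_t+e_u+e_p,m_t+m_u+m_p,f_t+f_u+f_p)}t[p/u]:\sigma$. A derivation is tight if its context and its type are tight. -}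

module Defs where

open import Data.Nat.Base using (ℕ; suc; _+_)
open import Data.Nat.Properties using (+-assoc)
open import Data.Fin.Base using (Fin; zero; suc; splitAt; _↑ˡ_; _↑ʳ_; cast)
open import Data.List.Base using (List; []; _∷_; _++_)
open import Data.List.Relation.Binary.Permutation.Homogeneous using (Permutation)
open import Data.List.Relation.Unary.All using (All)
open import Data.Vec.Base as Vec using (Vec; take; drop; replicate; zipWith; _[_]≔_)
open import Data.Vec.Relation.Binary.Pointwise.Inductive using (Pointwise)
import Data.Vec.Relation.Unary.All as Vec
open import Data.Empty using (⊥)
open import Data.Product.Base using (_×_)
open import Data.Sum.Base using ([_,_]′)
open import Function.Base using (_∘_; id)
open import Relation.Nullary.Negation.Core using (¬_)
open import Relation.Binary.PropositionalEquality.Core using (_≡_)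

infixl 25 _[_/_]
infixl 24 _·_
infix  23 _⟪_⟫
infixr 20 _⇒_
infixr 21 _⊗_
infixl 15 _∧_
infix  4 _≈_ _≋_ _≋ᶜ_

-- Terms modulo α are well-scoped de Bruijn terms: `Term n` has its free
-- variables among n.  A pattern is a tree whose leaves are its variables,
-- numbered from left to right; linearity, and the disjointness p # q in a pair
-- pattern, hold by construction.

data Pat : Set where
  ν     : Pat
  ⟨_,_⟩ : Pat → Pat → Pat

∣_∣ : Pat → ℕ
∣ ν ∣         = 1
∣ ⟨ p , q ⟩ ∣ = ∣ p ∣ + ∣ q ∣

-- In `ƛ p t` and `t [ p / u ]`, the first ∣ p ∣ variables of t are those of p.

data Term (n : ℕ) : Set where
  var   : Fin n → Term n
  ƛ     : (p : Pat) → Term (∣ p ∣ + n) → Term n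
  ⟨_,_⟩ : Term n → Term n → Term n
  _·_   : Term n → Term n → Term n
  match : (p : Pat) → Term (∣ p ∣ + n) → Term n → Term n

pattern _[_/_] t p u = match p t u

lift : ∀ k {m n} → (Fin m → Fin n) → Fin (k + m) → Fin (k + n)
lift k {n = n} ρ i = [ _↑ˡ n , (k ↑ʳ_) ∘ ρ ]′ (splitAt k i)

rename : ∀ {m n} → (Fin m → Fin n) → Term m → Term n
rename ρ (var x)       = var (ρ x)
rename ρ (ƛ p t)       = ƛ p (rename (lift ∣ p ∣ ρ) t)
rename ρ ⟨ t , u ⟩     = ⟨ rename ρ t , rename ρ u ⟩
rename ρ (t · u)       = rename ρ t · rename ρ u
rename ρ (t [ p / u ]) = rename (lift ∣ p ∣ ρ) t [ p / rename ρ u ]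

weaken : ∀ k {n} → Term n → Term (k + n)
weaken k = rename (k ↑ʳ_)

liftₛ : ∀ k {m n} → (Fin m → Term n) → Fin (k + m) → Term (k + n)
liftₛ k {n = n} θ i = [ var ∘ (_↑ˡ n) , weaken k ∘ θ ]′ (splitAt k i)

subst : ∀ {m n} → (Fin m → Term n) → Term m → Term n
subst θ (var x)       = θ x
subst θ (ƛ p t)       = ƛ p (subst (liftₛ ∣ p ∣ θ) t)
subst θ ⟨ t , u ⟩     = ⟨ subst θ t , subst θ u ⟩
subst θ (t · u)       = subst θ t · subst θ u
subst θ (t [ p / u ]) = subst (liftₛ ∣ p ∣ θ) t [ p / subst θ u ]

-- t{x/u}, where x is the variable bound by the pattern ν.
_⁅_⁆ : ∀ {n} → Term (∣ ν ∣ + n) → Term n → Term n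
t ⁅ u ⁆ = subst (λ { zero → u ; (suc x) → var x }) t

-- `LCtx n m`: a list context in scope n whose hole is in scope m.

data LCtx : ℕ → ℕ → Set where
  □      : ∀ {n} → LCtx n n
  matchᴸ : ∀ {n m} (p : Pat) → LCtx (∣ p ∣ + n) m → Term n → LCtx n m

_⟪_⟫ : ∀ {n m} → LCtx n m → Term m → Term n
□            ⟪ t ⟫ = t
matchᴸ p L u ⟪ t ⟫ = (L ⟪ t ⟫) [ p / u ]

-- The inclusion of the outer scope of L into the scope of its hole.  Moving
-- terms under L along it replaces the side conditions bv(L) ∩ fv(_) = ∅.
under : ∀ {n m} → LCtx n m → Fin n → Fin m
under □              = id
under (matchᴸ p L u) = under L ∘ (∣ p ∣ ↑ʳ_)

data Abs {n} (t : Term n) : Set where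
  abs : ∀ {m} (L : LCtx n m) p u → t ≡ L ⟪ ƛ p u ⟫ → Abs t

data Kind : Set where
  𝕓 𝕖 𝕞 : Kind

Reducts : ℕ → Set₁
Reducts n = Kind → Term n → Set

Irreducible : ∀ {n} → Reducts n → Set
Irreducible t→ = ∀ κ t′ → ¬ t→ κ t′

-- Head reduction occurs negatively in its own rules (through t ↛), but only at
-- immediate subterms of the source.  It is therefore defined by recursion on
-- the source: below, t→ and u→ stand for the reducts of t and of u.

data LamStep {n} (p : Pat) (t→ : Reducts (∣ p ∣ + n)) : Reducts n where
  under-ƛ : ∀ {κ t′} → t→ κ t′ → LamStep p t→ κ (ƛ p t′)

data AppStep {n} (t : Term n) (t→ : Reducts n) (u : Term n) : Reducts n where
  b-step   : ∀ {m} (L : LCtx n m) p s → t ≡ L ⟪ ƛ p s ⟫ →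
             AppStep t t→ u 𝕓 (L ⟪ s [ p / rename (under L) u ] ⟫)
  app-left : ∀ {κ t′} → ¬ Abs t → t→ κ t′ → AppStep t t→ u κ (t′ · u)

data VarMatchStep {n} (t : Term (∣ ν ∣ + n)) (t→ : Reducts (∣ ν ∣ + n)) (u : Term n) : Reducts n where
  e-step     : Irreducible t→ → VarMatchStep t t→ u 𝕖 (t ⁅ u ⁆)
  match-left : ∀ {κ t′} → t→ κ t′ → VarMatchStep t t→ u κ (t′ [ ν / u ])

-- In the contractum t[p₁/u₁][p₂/u₂] of (m), the variables of p₂ scope over
-- t[p₁/u₁] but must not capture in u₁, which is therefore weakened.
data PairMatchStep {n} (p₁ p₂ : Pat) (t : Term (∣ ⟨ p₁ , p₂ ⟩ ∣ + n)) (t→ : Reducts (∣ ⟨ p₁ , p₂ ⟩ ∣ + n))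
                   (u : Term n) (u→ : Reducts n) : Reducts n where
  m-step      : ∀ {m} (L : LCtx n m) u₁ u₂ → u ≡ L ⟪ ⟨ u₁ , u₂ ⟩ ⟫ → Irreducible t→ →
                PairMatchStep p₁ p₂ t t→ u u→ 𝕞
                  (L ⟪ (rename (cast (+-assoc ∣ p₁ ∣ ∣ p₂ ∣ m) ∘ lift ∣ ⟨ p₁ , p₂ ⟩ ∣ (under L)) t
                         [ p₁ / weaken ∣ p₂ ∣ u₁ ])
                       [ p₂ / u₂ ] ⟫)
  match-left  : ∀ {κ t′} → t→ κ t′ → PairMatchStep p₁ p₂ t t→ u u→ κ (t′ [ ⟨ p₁ , p₂ ⟩ / u ])
  match-right : ∀ {κ u′} → Irreducible t→ → u→ κ u′ →
                PairMatchStep p₁ p₂ t t→ u u→ κ (t [ ⟨ p₁ , p₂ ⟩ / u′ ])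

HeadStep : ∀ {n} → Term n → Reducts n
HeadStep (var x)               κ s = ⊥
HeadStep (ƛ p t)                   = LamStep p (HeadStep t)
HeadStep ⟨ t , u ⟩             κ s = ⊥
HeadStep (t · u)                   = AppStep t (HeadStep t) u
HeadStep (t [ ν / u ])             = VarMatchStep t (HeadStep t) u
HeadStep (t [ ⟨ p₁ , p₂ ⟩ / u ])   = PairMatchStep p₁ p₂ t (HeadStep t) u (HeadStep u)

infix 4 _⟶ₕ[_]_ _⟶ₕ[_,_,_]_

_⟶ₕ[_]_ : ∀ {n} → Term n → Kind → Term n → Set
t ⟶ₕ[ κ ] s = HeadStep t κ s

data _⟶ₕ[_,_,_]_ {n} : Term n → ℕ → ℕ → ℕ → Term n → Set where
  done : ∀ {t} → t ⟶ₕ[ 0 , 0 , 0 ] t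
  b∷   : ∀ {t s u b e m} → t ⟶ₕ[ 𝕓 ] s → s ⟶ₕ[ b , e , m ] u → t ⟶ₕ[ suc b , e , m ] u
  e∷   : ∀ {t s u b e m} → t ⟶ₕ[ 𝕖 ] s → s ⟶ₕ[ b , e , m ] u → t ⟶ₕ[ b , suc e , m ] u
  m∷   : ∀ {t s u b e m} → t ⟶ₕ[ 𝕞 ] s → s ⟶ₕ[ b , e , m ] u → t ⟶ₕ[ b , e , suc m ] u

data 𝓝 {n} : Term n → Set where
  var   : ∀ x → 𝓝 (var x)
  app   : ∀ {t} → 𝓝 t → ∀ u → 𝓝 (t · u)
  match : ∀ {p₁ p₂ t u} → 𝓝 t → 𝓝 u → 𝓝 (t [ ⟨ p₁ , p₂ ⟩ / u ])

data 𝓜 {n} : Term n → Set where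
  lam   : ∀ {p t} → 𝓜 t → 𝓜 (ƛ p t)
  pair  : ∀ t u → 𝓜 ⟨ t , u ⟩
  match : ∀ {p₁ p₂ t u} → 𝓜 t → 𝓝 u → 𝓜 (t [ ⟨ p₁ , p₂ ⟩ / u ])
  neut  : ∀ {t} → 𝓝 t → 𝓜 t

-- Only meaningful on canonical forms; total because its clauses depend only on
-- the shape of the term.
size : ∀ {n} → Term n → ℕ
size (var x)       = 0
size (ƛ p t)       = size t + 1
size ⟨ t , u ⟩     = 1
size (t · u)       = size t + 1
size (t [ p / u ]) = size t + size u + 1

data TightTy : Set where
  •𝓝 •𝓜 : TightTy

data Ty : Set

-- Multi-types are lists, compared by _≋_ below.
MTy : Set
MTy = List Ty

data Ty where
  tight : TightTy → Ty
  _⊗_   : MTy → MTy → Ty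
  _⇒_   : MTy → Ty → Ty

-- Equality of types and of multi-types, where multi-types are finite multisets
-- at every depth.

data _≈_ : Ty → Ty → Set

_≋_ : MTy → MTy → Set
_≋_ = Permutation _≈_

data _≈_ where
  tight : ∀ τ → tight τ ≈ tight τ
  _⊗_   : ∀ {A A′ B B′} → A ≋ A′ → B ≋ B′ → (A ⊗ B) ≈ (A′ ⊗ B′)
  _⇒_   : ∀ {A A′ σ σ′} → A ≋ A′ → σ ≈ σ′ → (A ⇒ σ) ≈ (A′ ⇒ σ′)

Ctx : ℕ → Set
Ctx n = Vec MTy n

_≋ᶜ_ : ∀ {n} → Ctx n → Ctx n → Set
_≋ᶜ_ = Pointwise _≋_

∅ : ∀ {n} → Ctx n
∅ {n} = replicate n []

_∧_ : ∀ {n} → Ctx n → Ctx n → Ctx n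
_∧_ = zipWith _++_

_∶[_] : ∀ {n} → Fin n → Ty → Ctx n
x ∶[ σ ] = ∅ [ x ]≔ (σ ∷ [])

data IsTight : Ty → Set where
  tight : ∀ τ → IsTight (tight τ)

TightCtx : ∀ {n} → Ctx n → Set
TightCtx = Vec.All (All IsTight)

-- Each judgement has a rule `conv`, which leaves the counters unchanged and
-- expresses that contexts and types are taken up to equality of multisets.

-- A context for p assigns multi-types to exactly the variables of p.  So
-- dom(Γ) ⊆ var(⟨p,q⟩) holds by construction in pat-p, and in pat-× the
-- union Γ ∧ Δ of contexts with disjoint domains is a concatenation.

data PatTyping : (p : Pat) → Ctx ∣ p ∣ → (e m f : ℕ) → MTy → Set

infix 3 PatTyping
syntax PatTyping p Γ e m f A = Γ ⊩[ e , m , f ] p ∶ A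

data PatTyping where
  pat-v : ∀ {A} → (A Vec.∷ Vec.[]) ⊩[ 1 , 0 , 0 ] ν ∶ A
  pat-× : ∀ {p q Γ Δ A B eₚ mₚ fₚ e_q m_q f_q} →
          Γ ⊩[ eₚ , mₚ , fₚ ] p ∶ A →
          Δ ⊩[ e_q , m_q , f_q ] q ∶ B →
          (Γ Vec.++ Δ) ⊩[ eₚ + e_q , 1 + mₚ + m_q , fₚ + f_q ] ⟨ p , q ⟩ ∶ (A ⊗ B ∷ [])
  pat-p : ∀ {p q Γ} → TightCtx Γ →
          Γ ⊩[ 0 , 0 , 1 ] ⟨ p , q ⟩ ∶ (tight •𝓝 ∷ [])
  conv  : ∀ {p Γ Γ′ A A′ e m f} → Γ ≋ᶜ Γ′ → A ≋ A′ →
          Γ ⊩[ e , m , f ] p ∶ A →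
          Γ′ ⊩[ e , m , f ] p ∶ A′

infix 3 _⊢[_,_,_,_]_∶_ _⊢*[_,_,_,_]_∶_

-- `take ∣ p ∣ Γ` is Γ|ₚ and `drop ∣ p ∣ Γ` is Γ ∖ var(p).

data _⊢[_,_,_,_]_∶_ {n : ℕ} : Ctx n → (b e m f : ℕ) → Term n → Ty → Set

-- Rule (many), with the finite family of premises given as a list.
data _⊢*[_,_,_,_]_∶_ {n : ℕ} : Ctx n → (b e m f : ℕ) → Term n → MTy → Set where
  []   : ∀ {t} → ∅ ⊢*[ 0 , 0 , 0 , 0 ] t ∶ []
  _∷_  : ∀ {t Γ Δ σ A b e m f b′ e′ m′ f′} →
         Γ ⊢[ b , e , m , f ] t ∶ σ →
         Δ ⊢*[ b′ , e′ , m′ , f′ ] t ∶ A →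
         Γ ∧ Δ ⊢*[ b + b′ , e + e′ , m + m′ , f + f′ ] t ∶ σ ∷ A
  conv : ∀ {t Γ Γ′ A A′ b e m f} → Γ ≋ᶜ Γ′ → A ≋ A′ →
         Γ ⊢*[ b , e , m , f ] t ∶ A →
         Γ′ ⊢*[ b , e , m , f ] t ∶ A′

data _⊢[_,_,_,_]_∶_ {n} where
  ax     : ∀ x {σ} → x ∶[ σ ] ⊢[ 0 , 0 , 0 , 0 ] var x ∶ σ
  lam    : ∀ {p t Γ σ A b e m f eₚ mₚ fₚ} →
           Γ ⊢[ b , e , m , f ] t ∶ σ →
           take ∣ p ∣ Γ ⊩[ eₚ , mₚ , fₚ ] p ∶ A →
           drop ∣ p ∣ Γ ⊢[ b + 1 , e + eₚ , m + mₚ , f + fₚ ] ƛ p t ∶ A ⇒ σ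
  lam-p  : ∀ {p t Γ τ b e m f} →
           Γ ⊢[ b , e , m , f ] t ∶ tight τ →
           TightCtx (take ∣ p ∣ Γ) →
           drop ∣ p ∣ Γ ⊢[ b , e , m , f + 1 ] ƛ p t ∶ tight •𝓜
  app    : ∀ {t u Γ Δ σ A bₜ eₜ mₜ fₜ bᵤ eᵤ mᵤ fᵤ} →
           Γ ⊢[ bₜ , eₜ , mₜ , fₜ ] t ∶ A ⇒ σ →
           Δ ⊢*[ bᵤ , eᵤ , mᵤ , fᵤ ] u ∶ A →
           Γ ∧ Δ ⊢[ bₜ + bᵤ , eₜ + eᵤ , mₜ + mᵤ , fₜ + fᵤ ] t · u ∶ σ
  app-p  : ∀ {t u Γ b e m f} →
           Γ ⊢[ b , e , m , f ] t ∶ tight •𝓝 →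
           Γ ⊢[ b , e , m , f + 1 ] t · u ∶ tight •𝓝
  pair   : ∀ {t u Γ Δ A B bₜ eₜ mₜ fₜ bᵤ eᵤ mᵤ fᵤ} →
           Γ ⊢*[ bₜ , eₜ , mₜ , fₜ ] t ∶ A →
           Δ ⊢*[ bᵤ , eᵤ , mᵤ , fᵤ ] u ∶ B →
           Γ ∧ Δ ⊢[ bₜ + bᵤ , eₜ + eᵤ , mₜ + mᵤ , fₜ + fᵤ ] ⟨ t , u ⟩ ∶ A ⊗ B
  pair-p : ∀ {t u} → ∅ ⊢[ 0 , 0 , 0 , 1 ] ⟨ t , u ⟩ ∶ tight •𝓜
  match  : ∀ {p t u Γ Δ σ A bₜ eₜ mₜ fₜ eₚ mₚ fₚ bᵤ eᵤ mᵤ fᵤ} →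
           Γ ⊢[ bₜ , eₜ , mₜ , fₜ ] t ∶ σ →
           take ∣ p ∣ Γ ⊩[ eₚ , mₚ , fₚ ] p ∶ A →
           Δ ⊢*[ bᵤ , eᵤ , mᵤ , fᵤ ] u ∶ A →
           drop ∣ p ∣ Γ ∧ Δ ⊢[ bₜ + bᵤ , eₜ + eᵤ + eₚ , mₜ + mᵤ + mₚ , fₜ + fᵤ + fₚ ] t [ p / u ] ∶ σ
  conv   : ∀ {t Γ Γ′ σ σ′ b e m f} → Γ ≋ᶜ Γ′ → σ ≈ σ′ →
           Γ ⊢[ b , e , m , f ] t ∶ σ →
           Γ′ ⊢[ b , e , m , f ] t ∶ σ′

TightDerivation : ∀ {n b e m f σ} {Γ : Ctx n} {t : Term n} → Γ ⊢[ b , e , m , f ] t ∶ σ → Set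
TightDerivation {σ = σ} {Γ = Γ} _ = TightCtx Γ × IsTight σ

{-# OPTIONS --safe #-}
module Submission where

-- Canonical forms are tightly typed with counters (0,0,0,|u|), and typing is
-- preserved backwards along each head step, at the cost of one unit of the
-- counter of its kind.  Expansion needs no tightness: a head step takes place in
-- a subterm that is typed exactly once, because the multi-type of a pair pattern
-- is a singleton.  The e-step rests on an anti-substitution lemma for arbitrary
-- simultaneous substitutions θ: a derivation of t θ splits into one of t in a
-- context Γ and, for every x, derivations of θ x with multi-type Γ(x).

open import Defs
open import Data.Nat.Base using (ℕ)
open import Data.Product.Base using (∃-syntax; Σ-syntax)

-- The pair constructor stays local to this module: with it in scope,
-- t ⟶ₕ[ b , e , m ] u could also be read as t ⟶ₕ[ κ ] u.
module Completeness where

  open import Algebra.Bundles using (CommutativeMonoid)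
  open import Algebra.Structures using (IsCommutativeMonoid)
  import Algebra.Construct.DirectProduct as DirectProduct
  import Algebra.Solver.CommutativeMonoid as CommutativeMonoidSolver
  open import Data.Fin.Base using (Fin; zero; suc; splitAt; _↑ˡ_; _↑ʳ_; cast; toℕ)
  open import Data.Fin.Properties using (splitAt-↑ˡ; splitAt-↑ʳ; toℕ-injective; toℕ-cast; toℕ-↑ˡ; toℕ-↑ʳ)
  open import Data.List.Base using ([]; _∷_; _++_)
  import Data.List.Relation.Binary.Permutation.Homogeneous as Homogeneous
  open import Data.List.Relation.Binary.Permutation.Propositional as ↭ using (_↭_; ↭-refl; ↭-isEquivalence)
  open import Data.List.Relation.Binary.Permutation.Propositional.Properties as ↭ using (All-resp-↭)
  import Data.List.Relation.Binary.Pointwise.Base as List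
  open import Data.List.Relation.Unary.All using ([]; _∷_)
  import Data.List.Relation.Unary.All.Properties as All
  open import Data.Nat.Base using (zero; suc; _+_)
  open import Data.Nat.Properties using (+-0-commutativeMonoid; +-identityʳ; +-assoc)
  open import Data.Product.Base using (∃₂; _×_; _,_; proj₁; proj₂)
  open import Data.Sum.Base using (inj₁; inj₂; [_,_]′)
  open import Data.Unit.Base using (⊤; tt)
  open import Data.Vec.Base as Vec using ([]; _∷_; take; drop)
  open import Data.Vec.Properties using (take-zipWith; drop-zipWith)
  open import Data.Vec.Relation.Binary.Pointwise.Inductive as Pointwise using (Pointwise; []; _∷_)
  import Data.Vec.Relation.Unary.All as Vec using ([]; _∷_)
  open import Function.Base using (_∘_)
  open import Level using (0ℓ)
  open import Relation.Binary.PropositionalEquality as ≡ using (_≡_; refl; sym; trans; cong; cong₂)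
  import Relation.Binary.Reasoning.Setoid as SetoidReasoning

  private
    variable
      k l m n e f : ℕ
      p : Pat
      σ : Ty
      A B : MTy

  -- Resources: contexts and counters as one commutative monoid

  infix 4 _~_ _↭ᶜ_
  infixl 15 _∙_
  infix 3 _⊢_∶_ _⊢*_∶_ _⊢ₛ_∶_

  -- Types are compared syntactically, which is finer than `_≋_`: no step of the proof permutes
  -- multi-types nested inside a type. `↭⇒≋` mediates where system 𝓔 is met.
  _↭ᶜ_ : Ctx n → Ctx n → Set
  _↭ᶜ_ = Pointwise _↭_

  contexts : ℕ → CommutativeMonoid 0ℓ 0ℓ
  contexts n = record
    { Carrier = Ctx n
    ; _≈_     = _↭ᶜ_
    ; _∙_     = _∧_
    ; ε       = ∅
    ; isCommutativeMonoid = record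
      { isMonoid = record
        { isSemigroup = record
          { isMagma = record
            { isEquivalence = Pointwise.isEquivalence ↭-isEquivalence n
            ; ∙-cong        = Pointwise.zipWith-cong ↭.++⁺
            }
          ; assoc = Pointwise.zipWith-assoc ↭.++-assoc
          }
        ; identity = Pointwise.zipWith-identityˡ ↭.++-identityˡ
                   , Pointwise.zipWith-identityʳ ↭.++-identityʳ
        }
      ; comm = Pointwise.zipWith-comm ↭.++-comm
      }
    }

  counters : CommutativeMonoid 0ℓ 0ℓ
  counters = ℕ₊ ⊠ (ℕ₊ ⊠ (ℕ₊ ⊠ ℕ₊))
    where
    ℕ₊  = +-0-commutativeMonoid
    _⊠_ = DirectProduct.commutativeMonoid

  module Contexts {n} = CommutativeMonoid (contexts n)
  module Counters = CommutativeMonoid counters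

  -- The counters (b , e , m , f).
  Count : Set
  Count = ℕ × ℕ × ℕ × ℕ

  Res : ℕ → Set
  Res n = Ctx n × Count

  record _~_ {n} (r s : Res n) : Set where
    constructor _,_
    field
      ctx   : proj₁ r ↭ᶜ proj₁ s
      count : proj₂ r Counters.≈ proj₂ s

  -- Opaque, so that unification can read off r and s from r ∙ s.
  opaque
    _∙_ : Res n → Res n → Res n
    (Γ , c) ∙ (Δ , d) = (Γ ∧ Δ) , (c Counters.∙ d)

  # : Count → Res n
  # c = ∅ , c

  ε : Res n
  ε = # (0 , 0 , 0 , 0)

  opaque
    unfolding _∙_

    ∙-isCommutativeMonoid : IsCommutativeMonoid (_~_ {n}) _∙_ ε
    ∙-isCommutativeMonoid = record
      { isMonoid = record
        { isSemigroup = record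
          { isMagma = record
            { isEquivalence = record
              { refl  = Contexts.refl , Counters.refl
              ; sym   = λ (γ , c) → Contexts.sym γ , Counters.sym c
              ; trans = λ (γ , c) (δ , d) → Contexts.trans γ δ , Counters.trans c d
              }
            ; ∙-cong = λ (γ , c) (δ , d) → Contexts.∙-cong γ δ , Counters.∙-cong c d
            }
          ; assoc = λ (Γ , c) (Δ , d) (Θ , e) → Contexts.assoc Γ Δ Θ , Counters.assoc c d e
          }
        ; identity = (λ (Γ , c) → Contexts.identityˡ Γ , Counters.identityˡ c)
                   , (λ (Γ , c) → Contexts.identityʳ Γ , Counters.identityʳ c)
        }
      ; comm = λ (Γ , c) (Δ , d) → Contexts.comm Γ Δ , Counters.comm c d
      }

  resources : ℕ → CommutativeMonoid 0ℓ 0ℓ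
  resources n = record
    { Carrier = Res n
    ; _≈_     = _~_
    ; _∙_     = _∙_
    ; ε       = ε
    ; isCommutativeMonoid = ∙-isCommutativeMonoid
    }

  module Resources {n} = CommutativeMonoid (resources n)
  open Resources using (∙-cong; ∙-congˡ; ∙-congʳ; identityˡ; identityʳ; reflexive)
    renaming (refl to ~-refl; sym to ~-sym; trans to ~-trans)
  module Solver {n} = CommutativeMonoidSolver (resources n)
  open Solver using (solve; _⊜_; _⊕_)
  module ↭ᶜ-Reasoning {n} = SetoidReasoning (Contexts.setoid {n})
  module ~-Reasoning {n} = SetoidReasoning (Resources.setoid {n})

  -- Resources at a binder

  opaque
    -- The counters go with `back`: a pattern typing has counters of its own and takes only the
    -- context `front`. `pad` is the form of a resource that does not depend on the bound variables
    -- and can leave their scope.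
    front : ∀ k → Res (k + n) → Ctx k
    front k (Γ , c) = take k Γ

    back : ∀ k → Res (k + n) → Res n
    back k (Γ , c) = drop k Γ , c

    pad : ∀ k → Res n → Res (k + n)
    pad k (Γ , c) = ∅ {k} Vec.++ Γ , c

  opaque
    unfolding _∙_ front back pad

    front-cong : ∀ k {r s : Res (k + n)} → r ~ s → front k r ↭ᶜ front k s
    front-cong k (γ , _) = go k γ
      where
      go : ∀ k {Γ Δ : Ctx (k + n)} → Γ ↭ᶜ Δ → take k Γ ↭ᶜ take k Δ
      go zero    γ       = []
      go (suc k) (α ∷ γ) = α ∷ go k γ

    back-cong : ∀ k {r s : Res (k + n)} → r ~ s → back k r ~ back k s
    back-cong k (γ , c) = go k γ , c
      where
      go : ∀ k {Γ Δ : Ctx (k + n)} → Γ ↭ᶜ Δ → drop k Γ ↭ᶜ drop k Δ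
      go zero    γ       = γ
      go (suc k) (α ∷ γ) = go k γ

    front-∙ : ∀ k (r s : Res (k + n)) → front k (r ∙ s) ≡ front k r ∧ front k s
    front-∙ k (Γ , _) (Δ , _) = take-zipWith _++_ Γ Δ

    back-∙ : ∀ k (r s : Res (k + n)) → back k (r ∙ s) ≡ back k r ∙ back k s
    back-∙ k (Γ , _) (Δ , _) = cong (_, _) (drop-zipWith {m = k} _++_ Γ Δ)

    take-++ : ∀ (Γ : Ctx k) (Δ : Ctx n) → take k (Γ Vec.++ Δ) ≡ Γ
    take-++ []      Δ = refl
    take-++ (A ∷ Γ) Δ = cong (A ∷_) (take-++ Γ Δ)

    drop-++ : ∀ (Γ : Ctx k) (Δ : Ctx n) → drop k (Γ Vec.++ Δ) ≡ Δ
    drop-++ []      Δ = refl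
    drop-++ (A ∷ Γ) Δ = drop-++ Γ Δ

    front-++ : ∀ (Γ : Ctx k) {Δ : Ctx n} {c} → front k (Γ Vec.++ Δ , c) ≡ Γ
    front-++ Γ = take-++ Γ _

    back-++ : ∀ (Γ : Ctx k) {Δ : Ctx n} {c} → back k (Γ Vec.++ Δ , c) ≡ (Δ , c)
    back-++ Γ = cong (_, _) (drop-++ Γ _)

    front-pad : ∀ k (r : Res n) → front k (pad k r) ≡ ∅
    front-pad k r = front-++ (∅ {k}) {c = proj₂ r}

    back-pad : ∀ k (r : Res n) → back k (pad k r) ≡ r
    back-pad k r = back-++ (∅ {k})

    pad-cong : ∀ k {r s : Res n} → r ~ s → pad k r ~ pad k s
    pad-cong k (γ , c) = Pointwise.++⁺ Contexts.refl γ , c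

    pad-∙ : ∀ k (r s : Res n) → pad k (r ∙ s) ≡ pad k r ∙ pad k s
    pad-∙ k (Γ , c) (Δ , d) = cong (_, _) (go k)
      where
      go : ∀ k → ∅ {k} Vec.++ (Γ ∧ Δ) ≡ (∅ {k} Vec.++ Γ) ∧ (∅ {k} Vec.++ Δ)
      go zero    = refl
      go (suc k) = cong ([] ∷_) (go k)

    ∅-++ : ∀ k → ∅ {k} Vec.++ ∅ {n} ≡ ∅
    ∅-++ zero    = refl
    ∅-++ (suc k) = cong ([] ∷_) (∅-++ k)

    pad-# : ∀ k c → pad k (# {n} c) ≡ # c
    pad-# k c = cong (_, c) (∅-++ k)

  -- Padding has an empty front. The two padded summands have the shape met in subject expansion: on
  -- the left the counter of the step, on the right a resource that leaves the scope.
  front-∙-pad : ∀ k {r s : Res (k + n)} {a b} → pad k a ∙ r ~ s ∙ pad k b → front k r ↭ᶜ front k s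
  front-∙-pad k {r} {s} {a} {b} eq = begin
    front k r                     ≈⟨ Contexts.identityˡ _ ⟨
    ∅ ∧ front k r                 ≡⟨ cong (_∧ front k r) (front-pad k a) ⟨
    front k (pad k a) ∧ front k r ≡⟨ front-∙ k (pad k a) r ⟨
    front k (pad k a ∙ r)         ≈⟨ front-cong k eq ⟩
    front k (s ∙ pad k b)         ≡⟨ front-∙ k s (pad k b) ⟩
    front k s ∧ front k (pad k b) ≡⟨ cong (front k s ∧_) (front-pad k b) ⟩
    front k s ∧ ∅                 ≈⟨ Contexts.identityʳ _ ⟩
    front k s                     ∎
    where open ↭ᶜ-Reasoning

  back-∙-pad : ∀ k {r s : Res (k + n)} {a b} → pad k a ∙ r ~ s ∙ pad k b → a ∙ back k r ~ back k s ∙ b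
  back-∙-pad k {r} {s} {a} {b} eq = begin
    a ∙ back k r                ≡⟨ cong (_∙ back k r) (back-pad k a) ⟨
    back k (pad k a) ∙ back k r ≡⟨ back-∙ k (pad k a) r ⟨
    back k (pad k a ∙ r)        ≈⟨ back-cong k eq ⟩
    back k (s ∙ pad k b)        ≡⟨ back-∙ k s (pad k b) ⟩
    back k s ∙ back k (pad k b) ≡⟨ cong (back k s ∙_) (back-pad k b) ⟩
    back k s ∙ b                ∎
    where open ~-Reasoning

  pad-ε-∙ : ∀ k {r s : Res (k + n)} → r ~ s → pad k ε ∙ r ~ s
  pad-ε-∙ k {r} eq = ~-trans (∙-congʳ (reflexive (pad-# k _))) (~-trans (identityˡ r) eq)

  -- Such a decomposition comes from a substitution lifted under a binder: the bound variables
  -- contribute `Γ`, the weakened terms the padded summand.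
  front-++-pad : ∀ k {r : Res (k + n)} {Γ s c} → r ~ (Γ Vec.++ ∅ , c) ∙ pad k s → Γ ↭ᶜ front k r
  front-++-pad k {Γ = Γ} eq =
    Contexts.sym (Contexts.trans (front-∙-pad k (pad-ε-∙ k eq)) (Contexts.reflexive (front-++ Γ)))

  back-++-pad : ∀ k {r : Res (k + n)} {Γ s c} → r ~ (Γ Vec.++ ∅ , c) ∙ pad k s → back k r ~ # c ∙ s
  back-++-pad k {Γ = Γ} eq =
    ~-trans (~-sym (identityˡ _)) (~-trans (back-∙-pad k (pad-ε-∙ k eq)) (∙-congʳ (reflexive (back-++ Γ))))

  TightCtx-resp : ∀ {Γ Δ : Ctx n} → Γ ↭ᶜ Δ → TightCtx Γ → TightCtx Δ
  TightCtx-resp []      Vec.[]       = Vec.[]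
  TightCtx-resp (α ∷ γ) (τ Vec.∷ τs) = All-resp-↭ α τ Vec.∷ TightCtx-resp γ τs

  -- Because of its rule conv, PatTyping implies this only up to ≋; it is
  -- therefore a separate premise of match.
  SingletonOnPair : Pat → MTy → Set
  SingletonOnPair ν         A = ⊤
  SingletonOnPair ⟨ p , q ⟩ A = ∃[ σ ] A ≡ σ ∷ []

  -- System 𝓔 with the context and the counters merged into a single resource,
  -- and with conversion of resources built into each rule, so that derivations
  -- can be inverted by pattern matching.
  data _⊢_∶_ {n} (r : Res n) : Term n → Ty → Set

  data _⊢*_∶_ {n} (r : Res n) : Term n → MTy → Set where
    nil  : ∀ {t} → r ~ ε → r ⊢* t ∶ []
    cons : ∀ {t s s′} → s ⊢ t ∶ σ → s′ ⊢* t ∶ A → r ~ s ∙ s′ → r ⊢* t ∶ σ ∷ A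

  data _⊢_∶_ {n} r where
    ax     : ∀ {x} → r ~ (x ∶[ σ ] , 0 , 0 , 0 , 0) → r ⊢ var x ∶ σ
    lam    : ∀ {s t} → s ⊢ t ∶ σ → front ∣ p ∣ s ⊩[ e , m , f ] p ∶ A →
             r ~ back ∣ p ∣ s ∙ # (1 , e , m , f) → r ⊢ ƛ p t ∶ A ⇒ σ
    lam-p  : ∀ {s t τ} → s ⊢ t ∶ tight τ → TightCtx (front ∣ p ∣ s) →
             r ~ back ∣ p ∣ s ∙ # (0 , 0 , 0 , 1) → r ⊢ ƛ p t ∶ tight •𝓜
    app    : ∀ {s s′ t u} → s ⊢ t ∶ A ⇒ σ → s′ ⊢* u ∶ A → r ~ s ∙ s′ → r ⊢ t · u ∶ σ
    app-p  : ∀ {s t u} → s ⊢ t ∶ tight •𝓝 → r ~ s ∙ # (0 , 0 , 0 , 1) → r ⊢ t · u ∶ tight •𝓝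
    pair   : ∀ {s s′ t u} → s ⊢* t ∶ A → s′ ⊢* u ∶ B → r ~ s ∙ s′ → r ⊢ ⟨ t , u ⟩ ∶ A ⊗ B
    pair-p : ∀ {t u} → r ~ # (0 , 0 , 0 , 1) → r ⊢ ⟨ t , u ⟩ ∶ tight •𝓜
    match  : ∀ {s s′ t u} → s ⊢ t ∶ σ → front ∣ p ∣ s ⊩[ e , m , f ] p ∶ A → SingletonOnPair p A →
             s′ ⊢* u ∶ A → r ~ back ∣ p ∣ s ∙ s′ ∙ # (0 , e , m , f) → r ⊢ t [ p / u ] ∶ σ

  ⊢-resp : ∀ {r s : Res n} {t} → r ~ s → r ⊢ t ∶ σ → s ⊢ t ∶ σ
  ⊢-resp r~s (ax eq)             = ax (~-trans (~-sym r~s) eq)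
  ⊢-resp r~s (lam d π eq)        = lam d π (~-trans (~-sym r~s) eq)
  ⊢-resp r~s (lam-p d τ eq)      = lam-p d τ (~-trans (~-sym r~s) eq)
  ⊢-resp r~s (app d d′ eq)       = app d d′ (~-trans (~-sym r~s) eq)
  ⊢-resp r~s (app-p d eq)        = app-p d (~-trans (~-sym r~s) eq)
  ⊢-resp r~s (pair d d′ eq)      = pair d d′ (~-trans (~-sym r~s) eq)
  ⊢-resp r~s (pair-p eq)         = pair-p (~-trans (~-sym r~s) eq)
  ⊢-resp r~s (match d π ι d′ eq) = match d π ι d′ (~-trans (~-sym r~s) eq)

  ⊢*-resp : ∀ {r s : Res n} {t} → r ~ s → r ⊢* t ∶ A → s ⊢* t ∶ A
  ⊢*-resp r~s (nil eq)       = nil (~-trans (~-sym r~s) eq)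
  ⊢*-resp r~s (cons d ds eq) = cons d ds (~-trans (~-sym r~s) eq)

  ⊢*-++ : ∀ {r s : Res n} {t} → r ⊢* t ∶ A → s ⊢* t ∶ B → r ∙ s ⊢* t ∶ A ++ B
  ⊢*-++ {s = s} (nil eq) ds′       = ⊢*-resp (~-sym (~-trans (∙-congʳ eq) (identityˡ s))) ds′
  ⊢*-++ {s = s} (cons {s = a} {s′ = b} d ds eq) ds′ =
    cons d (⊢*-++ ds ds′) (~-trans (∙-congʳ eq) (Resources.assoc a b s))

  -- Embedding into system 𝓔

  ≈-refl : ∀ {σ} → σ ≈ σ
  ≋-refl : ∀ {A} → List.Pointwise _≈_ A A
  ≈-refl {tight τ} = tight τ
  ≈-refl {A ⊗ B}   = Homogeneous.refl ≋-refl ⊗ Homogeneous.refl ≋-refl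
  ≈-refl {A ⇒ σ}   = Homogeneous.refl ≋-refl ⇒ ≈-refl
  ≋-refl {[]}      = List.[]
  ≋-refl {σ ∷ A}   = ≈-refl List.∷ ≋-refl

  ↭⇒≋ : A ↭ B → A ≋ B
  ↭⇒≋ ↭.refl         = Homogeneous.refl ≋-refl
  ↭⇒≋ (↭.prep _ p)   = Homogeneous.prep ≈-refl (↭⇒≋ p)
  ↭⇒≋ (↭.swap _ _ p) = Homogeneous.swap ≈-refl ≈-refl (↭⇒≋ p)
  ↭⇒≋ (↭.trans p q)  = Homogeneous.trans (↭⇒≋ p) (↭⇒≋ q)

  -- Pattern derivations are only transported and assembled, never inverted, so the judgement of
  -- system 𝓔 with its rule `conv` is kept for them.
  ⊩-resp : ∀ {Γ Δ A} → Γ ↭ᶜ Δ → Γ ⊩[ e , m , f ] p ∶ A → Δ ⊩[ e , m , f ] p ∶ A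
  ⊩-resp γ = conv (Pointwise.map ↭⇒≋ γ) (Homogeneous.refl ≋-refl)

  Derivable : Res n → Term n → Ty → Set
  Derivable (Γ , b , e , m , f) t σ = Γ ⊢[ b , e , m , f ] t ∶ σ

  Derivable* : Res n → Term n → MTy → Set
  Derivable* (Γ , b , e , m , f) t A = Γ ⊢*[ b , e , m , f ] t ∶ A

  Derivable-resp : ∀ {r s : Res n} {t} → r ~ s → Derivable r t σ → Derivable s t σ
  Derivable-resp (γ , refl , refl , refl , refl) = conv (Pointwise.map ↭⇒≋ γ) ≈-refl

  Derivable*-resp : ∀ {r s : Res n} {t} → r ~ s → Derivable* r t A → Derivable* s t A
  Derivable*-resp (γ , refl , refl , refl , refl) = conv (Pointwise.map ↭⇒≋ γ) (Homogeneous.refl ≋-refl)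

  opaque
    unfolding _∙_ front back pad

    +-id : ∀ {i} → i ≡ i + 0
    +-id = sym (+-identityʳ _)

    derive  : ∀ {r : Res n} {t} → r ⊢ t ∶ σ → Derivable r t σ
    derive* : ∀ {r : Res n} {t} → r ⊢* t ∶ A → Derivable* r t A

    derive (ax eq) = Derivable-resp (~-sym eq) (ax _)
    -- With `_∙_` unfolded, the counters of `lam` agree by computation and only the empty context of
    -- `#` has to be removed. Rules that leave a counter alone also need `+-id`.
    derive (lam {s = Γ , b , e , m , f} d π eq) =
      Derivable-resp (~-trans (Contexts.sym (Contexts.identityʳ _) , Counters.refl) (~-sym eq))
                     (lam (derive d) π)
    derive (lam-p {s = Γ , b , e , m , f} d τ eq) =
      Derivable-resp (~-trans (Contexts.sym (Contexts.identityʳ _) , +-id , +-id , +-id , refl) (~-sym eq))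
                     (lam-p (derive d) τ)
    derive (app d ds eq) = Derivable-resp (~-sym eq) (app (derive d) (derive* ds))
    derive (app-p d eq) =
      Derivable-resp (~-trans (Contexts.sym (Contexts.identityʳ _) , +-id , +-id , +-id , refl) (~-sym eq))
                     (app-p (derive d))
    derive (pair ds ds′ eq) = Derivable-resp (~-sym eq) (pair (derive* ds) (derive* ds′))
    derive (pair-p eq) = Derivable-resp (~-sym eq) pair-p
    derive (match d π _ ds eq) =
      Derivable-resp (~-trans (Contexts.sym (Contexts.identityʳ _) , +-id , refl , refl , refl) (~-sym eq))
                     (match (derive d) π (derive* ds))

    derive* (nil eq)       = Derivable*-resp (~-sym eq) []
    derive* (cons d ds eq) = Derivable*-resp (~-sym eq) (derive d ∷ derive* ds)

  -- Canonical forms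

  TightCtx-∅ : TightCtx (∅ {n})
  TightCtx-∅ {zero}  = Vec.[]
  TightCtx-∅ {suc n} = [] Vec.∷ TightCtx-∅

  TightCtx-∶[] : ∀ (x : Fin n) τ → TightCtx (x ∶[ tight τ ])
  TightCtx-∶[] zero    τ = (tight τ ∷ []) Vec.∷ TightCtx-∅
  TightCtx-∶[] (suc x) τ = [] Vec.∷ TightCtx-∶[] x τ

  TightCtx-∧ : ∀ {Γ Δ : Ctx n} → TightCtx Γ → TightCtx Δ → TightCtx (Γ ∧ Δ)
  TightCtx-∧ Vec.[]       Vec.[]       = Vec.[]
  TightCtx-∧ (τ Vec.∷ τs) (υ Vec.∷ υs) = All.++⁺ τ υ Vec.∷ TightCtx-∧ τs υs

  TightCtx-take : ∀ k {Γ : Ctx (k + n)} → TightCtx Γ → TightCtx (take k Γ)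
  TightCtx-take zero            τs           = Vec.[]
  TightCtx-take (suc k) {A ∷ Γ} (τ Vec.∷ τs) = τ Vec.∷ TightCtx-take k τs

  TightCtx-drop : ∀ k {Γ : Ctx (k + n)} → TightCtx Γ → TightCtx (drop k Γ)
  TightCtx-drop zero            τs           = τs
  TightCtx-drop (suc k) {A ∷ Γ} (τ Vec.∷ τs) = TightCtx-drop k τs

  Canonical : Term n → TightTy → Set
  Canonical t τ = ∃[ Γ ] (TightCtx Γ × (Γ , 0 , 0 , 0 , size t) ⊢ t ∶ tight τ)

  opaque
    unfolding _∙_ front back pad

    -- `pat-p` asks for one derivation of u, of type `•𝓝`, and contributes the 1 in the size of the
    -- match. It requires the pattern variables to be tight, so tightness of contexts is carried
    -- through the induction.
    match-canonical : ∀ {p₁ p₂ t τ} {u : Term n} →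
                      Canonical t τ → Canonical u •𝓝 → Canonical (t [ ⟨ p₁ , p₂ ⟩ / u ]) τ
    match-canonical {p₁ = p₁} {p₂} (Γ , τΓ , d) (Δ , τΔ , d′) =
        _ , TightCtx-∧ (TightCtx-drop w τΓ) τΔ
      , match d (pat-p (TightCtx-take w τΓ)) (_ , refl) (cons d′ (nil ~-refl) (~-sym (identityʳ _)))
              (Contexts.sym (Contexts.identityʳ _) , refl , refl , refl , refl)
      where
      w : ℕ
      w = ∣ ⟨ p₁ , p₂ ⟩ ∣

    -- The type has to be `•𝓝`, not just tight: `app-p` requires it of the head and `pat-p` of the
    -- matched term. `app-p` leaves the argument untyped, so that any term may stand there.
    neutral : ∀ {t : Term n} → 𝓝 t → Canonical t •𝓝
    neutral (var x)   = _ , TightCtx-∶[] x •𝓝 , ax ~-refl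
    neutral (app t u) with neutral t
    ... | Γ , τΓ , d = Γ , τΓ , app-p d (Contexts.sym (Contexts.identityʳ _) , refl , refl , refl , refl)
    neutral (match t u) = match-canonical (neutral t) (neutral u)

    canonical : ∀ {t : Term n} → 𝓜 t → ∃[ τ ] Canonical t τ
    canonical (lam {p = p} t) with canonical t
    ... | _ , Γ , τΓ , d = •𝓜 , _ , TightCtx-drop ∣ p ∣ τΓ
                         , lam-p d (TightCtx-take ∣ p ∣ τΓ)
                                 (Contexts.sym (Contexts.identityʳ _) , refl , refl , refl , refl)
    canonical (pair t u)  = •𝓜 , _ , TightCtx-∅ , pair-p ~-refl
    canonical (match t u) with canonical t
    ... | τ , c = τ , match-canonical c (neutral u)
    canonical (neut t)    = •𝓝 , neutral t

  -- Typed substitutions and anti-substitution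

  -- r ⊢ₛ θ ∶ (Γ , c): the resource r consists of c and of what is needed to give
  -- each term θ x the multi-type Γ(x).
  data _⊢ₛ_∶_ {n} (r : Res n) : (Fin m → Term n) → Res m → Set where
    nil  : ∀ {θ c} → r ~ # c → r ⊢ₛ θ ∶ ([] , c)
    cons : ∀ {θ : Fin (suc m) → Term n} {Γ c s s′} →
           s ⊢* θ zero ∶ A → s′ ⊢ₛ θ ∘ suc ∶ (Γ , c) → r ~ s ∙ s′ → r ⊢ₛ θ ∶ (A ∷ Γ , c)

  ⊢ₛ-resp : ∀ {r r′ : Res n} {θ : Fin m → Term n} {s} → r ~ r′ → r ⊢ₛ θ ∶ s → r′ ⊢ₛ θ ∶ s
  ⊢ₛ-resp r~r′ (nil eq)      = nil (~-trans (~-sym r~r′) eq)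
  ⊢ₛ-resp r~r′ (cons d δ eq) = cons d δ (~-trans (~-sym r~r′) eq)

  -- Stands in for function extensionality, since lifted substitutions and composed renamings are
  -- known to agree only pointwise.
  ⊢ₛ-ext : ∀ {r : Res n} {θ θ′ : Fin m → Term n} {s} →
           (∀ x → θ x ≡ θ′ x) → r ⊢ₛ θ ∶ s → r ⊢ₛ θ′ ∶ s
  ⊢ₛ-ext θ≗θ′ (nil eq)       = nil eq
  ⊢ₛ-ext θ≗θ′ (cons d δ eq) =
    cons (≡.subst (_ ⊢*_∶ _) (θ≗θ′ zero) d) (⊢ₛ-ext (θ≗θ′ ∘ suc) δ) eq

  ⊢ₛ-# : ∀ {θ : Fin m → Term n} c → # c ⊢ₛ θ ∶ # c
  ⊢ₛ-# {m = zero}  c = nil ~-refl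
  ⊢ₛ-# {m = suc m} c = cons (nil ~-refl) (⊢ₛ-# c) (~-sym (identityˡ _))

  ⊢ₛ-∶[] : ∀ {r : Res n} {θ : Fin m → Term n} x →
           r ⊢ θ x ∶ σ → r ⊢ₛ θ ∶ (x ∶[ σ ] , 0 , 0 , 0 , 0)
  ⊢ₛ-∶[] zero    d = cons (cons d (nil ~-refl) (~-sym (identityʳ _))) (⊢ₛ-# _) (~-sym (identityʳ _))
  ⊢ₛ-∶[] (suc x) d = cons (nil ~-refl) (⊢ₛ-∶[] x d) (~-sym (identityˡ _))

  opaque
    unfolding _∙_ front back pad

    #-∙ : ∀ c d {Γ : Ctx n} → # c ∙ (Γ , d) ~ (Γ , c Counters.∙ d)
    #-∙ c d = Contexts.identityˡ _ , Counters.refl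

    -- For every x, the derivations of `θ x` demanded by the two contexts are concatenated. This
    -- additivity lets anti-substitution treat the premises of a rule separately.
    ⊢ₛ-∙ : ∀ {r r′ : Res n} {θ : Fin m → Term n} {s s′} →
           r ⊢ₛ θ ∶ s → r′ ⊢ₛ θ ∶ s′ → r ∙ r′ ⊢ₛ θ ∶ s ∙ s′
    ⊢ₛ-∙ (nil {c = c} eq) (nil {c = d} eq′) = nil (~-trans (∙-cong eq eq′) (#-∙ c d))
    ⊢ₛ-∙ (cons {s = a} {s′ = b} d δ eq) (cons {s = a′} {s′ = b′} d′ δ′ eq′) =
      cons (⊢*-++ d d′) (⊢ₛ-∙ δ δ′)
           (~-trans (∙-cong eq eq′)
                    (solve 4 (λ a b c d → (a ⊕ b) ⊕ (c ⊕ d) ⊜ (a ⊕ c) ⊕ (b ⊕ d)) ~-refl a b a′ b′))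

    ⊢ₛ-pad : ∀ k {r : Res n} {θ : Fin (k + m) → Term n} {s} → r ⊢ₛ θ ∘ (k ↑ʳ_) ∶ s → r ⊢ₛ θ ∶ pad k s
    ⊢ₛ-pad zero    δ = δ
    ⊢ₛ-pad (suc k) δ = cons (nil ~-refl) (⊢ₛ-pad k δ) (~-sym (identityˡ _))

  -- The whole counter goes to the second part, as it does with `back`.
  ⊢ₛ-split : ∀ (Γ : Ctx k) {Δ : Ctx m} {r : Res n} {θ c} → r ⊢ₛ θ ∶ (Γ Vec.++ Δ , c) →
             ∃₂ λ r₁ r₂ → r₁ ⊢ₛ θ ∘ (_↑ˡ m) ∶ (Γ , 0 , 0 , 0 , 0) ×
                          r₂ ⊢ₛ θ ∘ (k ↑ʳ_) ∶ (Δ , c) × r ~ r₁ ∙ r₂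
  ⊢ₛ-split []      δ = ε , _ , nil ~-refl , δ , ~-sym (identityˡ _)
  ⊢ₛ-split (_ ∷ Γ) (cons {s = a} d δ eq) with ⊢ₛ-split Γ δ
  ... | r₁ , r₂ , δ₁ , δ₂ , eq′ =
    a ∙ r₁ , r₂ , cons d δ₁ ~-refl , δ₂ , ~-trans eq (~-trans (∙-congˡ eq′) (~-sym (Resources.assoc a r₁ r₂)))

  -- `ax` types only the variable that it mentions, so a derivation for a weakened term demands
  -- nothing of the new variables. This is a predicate on single terms because the case of variables
  -- comes first and serves to prove the others.
  Strengthenable : Term n → Set
  Strengthenable {n} t = ∀ k {r σ} → r ⊢ weaken k t ∶ σ → ∃[ s ] (r ~ pad k s × s ⊢ t ∶ σ)

  strengthen* : ∀ {t : Term n} → Strengthenable t → ∀ k {r} →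
                r ⊢* weaken k t ∶ A → ∃[ s ] (r ~ pad k s × s ⊢* t ∶ A)
  strengthen* str k (nil eq) = ε , ~-trans eq (reflexive (sym (pad-# k _))) , nil ~-refl
  strengthen* str k (cons d ds eq) with str k d | strengthen* str k ds
  ... | s , r~s , d′ | s′ , r~s′ , ds′ =
    s ∙ s′ , ~-trans eq (~-trans (∙-cong r~s r~s′) (reflexive (sym (pad-∙ k s s′)))) , cons d′ ds′ ~-refl

  strengthenₛ : ∀ {θ : Fin m → Term n} → (∀ x → Strengthenable (θ x)) → ∀ k {r s} →
                r ⊢ₛ weaken k ∘ θ ∶ s → ∃[ r′ ] (r ~ pad k r′ × r′ ⊢ₛ θ ∶ s)
  strengthenₛ str k (nil eq) = # _ , ~-trans eq (reflexive (sym (pad-# k _))) , nil ~-refl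
  strengthenₛ str k (cons d δ eq) with strengthen* (str zero) k d | strengthenₛ (str ∘ suc) k δ
  ... | s , r~s , d′ | s′ , r~s′ , δ′ =
    s ∙ s′ , ~-trans eq (~-trans (∙-cong r~s r~s′) (reflexive (sym (pad-∙ k s s′)))) , cons d′ δ′ ~-refl

  opaque
    unfolding _∙_ front back pad

    ↑ʳ-∶[] : ∀ k (x : Fin n) → (k ↑ʳ x) ∶[ σ ] ≡ ∅ {k} Vec.++ (x ∶[ σ ])
    ↑ʳ-∶[] zero    x = refl
    ↑ʳ-∶[] (suc k) x = cong ([] ∷_) (↑ʳ-∶[] k x)

    strengthen-var : ∀ (x : Fin n) → Strengthenable (var x)
    strengthen-var x k (ax eq) = _ , ~-trans eq (reflexive (cong (_, _) (↑ʳ-∶[] k x))) , ax ~-refl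

    ⊢*-var-zero : ∀ {r : Res (suc n)} → r ⊢* var zero ∶ A → r ~ (A ∷ ∅ , 0 , 0 , 0 , 0)
    ⊢*-var-zero (nil eq)               = eq
    ⊢*-var-zero (cons (ax eq) ds eq′) =
      ~-trans eq′ (~-trans (∙-cong eq (⊢*-var-zero ds)) (↭-refl ∷ Contexts.identityˡ _ , Counters.refl))

    ∷-∙-pad : ∀ {c} {Γ : Ctx n} {r s s′ s″} → s ⊢* var zero ∶ A → s′ ~ pad 1 s″ → s″ ~ (Γ , c) →
              r ~ s ∙ s′ → r ~ (A ∷ Γ , c)
    ∷-∙-pad ds eq₁ eq₂ eq =
      ~-trans eq (~-trans (∙-cong (⊢*-var-zero ds) (~-trans eq₁ (pad-cong 1 eq₂)))
                          (↭.++-identityʳ _ ∷ Contexts.identityˡ _ , Counters.refl))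

  -- Each variable is typed by `ax` alone, so the identity substitution consumes exactly the context
  -- that it provides.
  ⊢ₛ-var : ∀ {r s : Res n} → r ⊢ₛ var ∶ s → r ~ s
  ⊢ₛ-var (nil eq) = eq
  ⊢ₛ-var (cons d δ eq) with strengthenₛ strengthen-var 1 δ
  -- The tail `var ∘ suc` is `weaken 1 ∘ var` by computation, hence the strengthening by 1.
  ... | s , eq′ , δ′ = ∷-∙-pad d eq′ (⊢ₛ-var δ′) eq

  ⊢ₛ-↑ˡ : ∀ {r : Res (k + n)} {Γ c} → r ⊢ₛ var ∘ (_↑ˡ n) ∶ (Γ , c) → r ~ (Γ Vec.++ ∅ , c)
  ⊢ₛ-↑ˡ (nil eq) = eq
  ⊢ₛ-↑ˡ {n = n} (cons d δ eq) with strengthenₛ (λ x → strengthen-var (x ↑ˡ n)) 1 δ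
  ... | s , eq′ , δ′ = ∷-∙-pad d eq′ (⊢ₛ-↑ˡ δ′) eq

  -- `liftₛ k θ` consists of the bound variables, which touch only the front, and of weakened terms,
  -- which strengthening keeps out of it.
  ⊢ₛ-lift : ∀ k {θ : Fin m → Term n} → (∀ x → Strengthenable (θ x)) → ∀ {r s} → r ⊢ₛ liftₛ k θ ∶ s →
            front k s ↭ᶜ front k r × back k r ⊢ₛ θ ∶ back k s
  ⊢ₛ-lift {m = m} k {θ} str {s = Γ , c} δ with Vec.splitAt k Γ
  ... | Γ₁ , Γ₂ , refl with ⊢ₛ-split Γ₁ δ
  ... | r₁ , r₂ , δ₁ , δ₂ , eq
    with strengthenₛ str k (⊢ₛ-ext (λ x → cong [ _ , _ ]′ (splitAt-↑ʳ k m x)) δ₂)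
  ... | r′ , eq₂ , δ₂′ =
      Contexts.trans (Contexts.reflexive (front-++ Γ₁)) (front-++-pad k eq′)
    , ≡.subst (_ ⊢ₛ θ ∶_) (sym (back-++ Γ₁)) (⊢ₛ-resp (~-sym (~-trans (back-++-pad k eq′) (identityˡ r′))) δ₂′)
    where
    eq′ = ~-trans eq (∙-cong (⊢ₛ-↑ˡ (⊢ₛ-ext (λ x → cong [ _ , _ ]′ (splitAt-↑ˡ k x m)) δ₁)) eq₂)

  -- Going under a binder weakens the terms of θ, which has to be undone.  The
  -- predicate P lets the lemma be proved once: for substitutions by variables,
  -- which are strengthened directly, and then for all terms, whose strengthening
  -- is the first instance.
  module AntiSubstitution
    (P : ∀ {n} → Term n → Set)
    (P-var : ∀ {n} (x : Fin n) → P (var x))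
    (P-weaken : ∀ {n} k {t : Term n} → P t → P (weaken k t))
    (P-strengthen : ∀ {n} (t : Term n) → P t → Strengthenable t)
    where

    P-lift : ∀ k {θ : Fin m → Term n} → (∀ x → P (θ x)) → ∀ x → P (liftₛ k θ x)
    P-lift k Pθ x with splitAt k x
    ... | inj₁ i = P-var _
    ... | inj₂ j = P-weaken k (Pθ j)

    anti-subst  : ∀ (t : Term m) {θ : Fin m → Term n} → (∀ x → P (θ x)) → ∀ {r} →
                  r ⊢ subst θ t ∶ σ → ∃[ s ] (s ⊢ t ∶ σ × r ⊢ₛ θ ∶ s)
    anti-subst* : ∀ (t : Term m) {θ : Fin m → Term n} → (∀ x → P (θ x)) → ∀ {r} →
                  r ⊢* subst θ t ∶ A → ∃[ s ] (s ⊢* t ∶ A × r ⊢ₛ θ ∶ s)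

    anti-subst (var x) Pθ d = _ , ax ~-refl , ⊢ₛ-∶[] x d
    anti-subst (ƛ p t) Pθ (lam d π eq) with anti-subst t (P-lift ∣ p ∣ Pθ) d
    ... | s , d′ , δ with ⊢ₛ-lift ∣ p ∣ (λ x → P-strengthen _ (Pθ x)) δ
    -- The bound variables keep their multi-types, so the pattern derivation is reused; the counters
    -- of the rule pass through `⊢ₛ-#`.
    ... | γ , δ′ = _ , lam d′ (⊩-resp (Contexts.sym γ) π) ~-refl , ⊢ₛ-resp (~-sym eq) (⊢ₛ-∙ δ′ (⊢ₛ-# _))
    anti-subst (ƛ p t) Pθ (lam-p d τ eq) with anti-subst t (P-lift ∣ p ∣ Pθ) d
    ... | s , d′ , δ with ⊢ₛ-lift ∣ p ∣ (λ x → P-strengthen _ (Pθ x)) δ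
    ... | γ , δ′ =
      _ , lam-p d′ (TightCtx-resp (Contexts.sym γ) τ) ~-refl , ⊢ₛ-resp (~-sym eq) (⊢ₛ-∙ δ′ (⊢ₛ-# _))
    anti-subst ⟨ t , u ⟩ Pθ (pair ds ds′ eq) with anti-subst* t Pθ ds | anti-subst* u Pθ ds′
    ... | s , d , δ | s′ , d′ , δ′ = _ , pair d d′ ~-refl , ⊢ₛ-resp (~-sym eq) (⊢ₛ-∙ δ δ′)
    anti-subst ⟨ t , u ⟩ Pθ (pair-p eq) = _ , pair-p ~-refl , ⊢ₛ-resp (~-sym eq) (⊢ₛ-# _)
    anti-subst (t · u) Pθ (app d ds eq) with anti-subst t Pθ d | anti-subst* u Pθ ds
    ... | s , d , δ | s′ , d′ , δ′ = _ , app d d′ ~-refl , ⊢ₛ-resp (~-sym eq) (⊢ₛ-∙ δ δ′)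
    anti-subst (t · u) Pθ (app-p d eq) with anti-subst t Pθ d
    ... | s , d , δ = _ , app-p d ~-refl , ⊢ₛ-resp (~-sym eq) (⊢ₛ-∙ δ (⊢ₛ-# _))
    anti-subst (t [ p / u ]) Pθ (match d π l ds eq) with anti-subst t (P-lift ∣ p ∣ Pθ) d | anti-subst* u Pθ ds
    ... | s , d′ , δ | s′ , ds′ , δs with ⊢ₛ-lift ∣ p ∣ (λ x → P-strengthen _ (Pθ x)) δ
    ... | γ , δ′ = _ , match d′ (⊩-resp (Contexts.sym γ) π) l ds′ ~-refl
                     , ⊢ₛ-resp (~-sym eq) (⊢ₛ-∙ (⊢ₛ-∙ δ′ δs) (⊢ₛ-# _))

    anti-subst* t Pθ (nil eq) = _ , nil ~-refl , ⊢ₛ-resp (~-sym eq) (⊢ₛ-# _)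
    anti-subst* t Pθ (cons d ds eq) with anti-subst t Pθ d | anti-subst* t Pθ ds
    ... | s , d′ , δ | s′ , ds′ , δ′ = _ , cons d′ ds′ ~-refl , ⊢ₛ-resp (~-sym eq) (⊢ₛ-∙ δ δ′)

  -- Makes anti-renaming an instance of anti-substitution. The hypothesis is pointwise so that it
  -- survives lifting.
  rename≡subst : ∀ (t : Term m) {ρ : Fin m → Fin n} {θ} → (∀ x → var (ρ x) ≡ θ x) → rename ρ t ≡ subst θ t
  rename≡subst-lift : ∀ k (t : Term (k + m)) {ρ : Fin m → Fin n} {θ} → (∀ x → var (ρ x) ≡ θ x) →
                      rename (lift k ρ) t ≡ subst (liftₛ k θ) t
  rename≡subst (var x) eq       = eq x
  rename≡subst (ƛ p t) eq       = cong (ƛ p) (rename≡subst-lift ∣ p ∣ t eq)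
  rename≡subst ⟨ t , u ⟩ eq     = cong₂ ⟨_,_⟩ (rename≡subst t eq) (rename≡subst u eq)
  rename≡subst (t · u) eq       = cong₂ _·_ (rename≡subst t eq) (rename≡subst u eq)
  rename≡subst (t [ p / u ]) eq = cong₂ (match p) (rename≡subst-lift ∣ p ∣ t eq) (rename≡subst u eq)
  rename≡subst-lift k t {ρ} {θ} eq = rename≡subst t lift-eq
    where
    lift-eq : ∀ x → var (lift k ρ x) ≡ liftₛ k θ x
    lift-eq x with splitAt k x
    ... | inj₁ i = refl
    ... | inj₂ j = cong (weaken k) (eq j)

  IsVar : Term n → Set
  IsVar t = ∃[ x ] t ≡ var x

  isVar-weaken : ∀ k {t : Term n} → IsVar t → IsVar (weaken k t)
  isVar-weaken k (x , refl) = k ↑ʳ x , refl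

  isVar-strengthen : ∀ (t : Term n) → IsVar t → Strengthenable t
  isVar-strengthen t (x , refl) = strengthen-var x

  module AntiRenaming = AntiSubstitution IsVar (λ x → x , refl) isVar-weaken isVar-strengthen

  anti-rename : ∀ (t : Term m) {ρ : Fin m → Fin n} {r} →
                r ⊢ rename ρ t ∶ σ → ∃[ s ] (s ⊢ t ∶ σ × r ⊢ₛ var ∘ ρ ∶ s)
  anti-rename t d = AntiRenaming.anti-subst t (λ x → _ , refl) (≡.subst (_ ⊢_∶ _) (rename≡subst t (λ _ → refl)) d)

  anti-rename* : ∀ (t : Term m) {ρ : Fin m → Fin n} {r} →
                 r ⊢* rename ρ t ∶ A → ∃[ s ] (s ⊢* t ∶ A × r ⊢ₛ var ∘ ρ ∶ s)
  anti-rename* t d = AntiRenaming.anti-subst* t (λ x → _ , refl) (≡.subst (_ ⊢*_∶ _) (rename≡subst t (λ _ → refl)) d)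

  -- Weakening is a renaming. Anti-renaming leaves a typing of the substitution by shifted
  -- variables, whose resource is padded; unpadded, it is the resource of the derivation for t by
  -- `⊢ₛ-var`.
  strengthen : ∀ (t : Term n) → Strengthenable t
  strengthen t k d with anti-rename t d
  ... | s , d′ , δ with strengthenₛ strengthen-var k δ
  ... | r′ , eq , δ′ = r′ , eq , ⊢-resp (~-sym (⊢ₛ-var δ′)) d′

  open AntiSubstitution (λ _ → ⊤) (λ _ → tt) (λ _ _ → tt) (λ t _ → strengthen t) using (anti-subst)

  -- Subject expansion

  -- Replaces t by t′ in the hole of L, moving out of L the part of the resource
  -- that does not mention the variables bound by L.
  frame : ∀ (L : LCtx n m) {t t′ c} (Q : Ty → Res n → Set) →
          (∀ {r} → r ⊢ t ∶ σ → ∃[ σ′ ] ∃[ s ] ∃[ d ] ∃[ s′ ]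
             s ⊢ t′ ∶ σ′ × d ⊢ₛ var ∘ under L ∶ s′ × Q σ′ s′ × # c ∙ r ~ s ∙ d) →
          ∀ {r} → r ⊢ L ⟪ t ⟫ ∶ σ →
          ∃[ σ′ ] ∃[ s ] ∃[ s′ ] s ⊢ L ⟪ t′ ⟫ ∶ σ′ × Q σ′ s′ × # c ∙ r ~ s ∙ s′
  frame □ Q h d with h d
  ... | _ , s , _ , s′ , d′ , δ , q , eq = _ , s , s′ , d′ , q , ~-trans eq (∙-congˡ (⊢ₛ-var δ))
  frame (matchᴸ p L u) {c = c} Q h {r} (match {e = e} {m} {f} {s = a} {s′ = b} d π l ds eq)
    -- The `Q` passed inwards also records that the resource moved out is padded, so that it can
    -- leave the scope of `p` as well.
    with frame L (λ σ′ s′ → ∃[ s″ ] s′ ≡ pad ∣ p ∣ s″ × Q σ′ s″)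
      (λ d → let _ , s , x , s′ , d′ , δ , q , eq = h d in
             _ , s , x , _ , d′ , ⊢ₛ-pad ∣ p ∣ δ , (s′ , refl , q) , eq) d
  ... | _ , s , _ , d′ , (s″ , refl , q) , eq′ =
    _ , s₀ ∙ b ∙ x , s″ , match d′ (⊩-resp (front-∙-pad ∣ p ∣ eq″) π) l ds ~-refl , q , (begin
      # c ∙ r              ≈⟨ ∙-congˡ eq ⟩
      # c ∙ (a₀ ∙ b ∙ x)   ≈⟨ solve 4 (λ c a b x → c ⊕ ((a ⊕ b) ⊕ x) ⊜ (c ⊕ a) ⊕ (b ⊕ x)) ~-refl (# c) a₀ b x ⟩
      # c ∙ a₀ ∙ (b ∙ x)   ≈⟨ ∙-congʳ (back-∙-pad ∣ p ∣ eq″) ⟩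
      s₀ ∙ s″ ∙ (b ∙ x)    ≈⟨ solve 4 (λ s c b x → (s ⊕ c) ⊕ (b ⊕ x) ⊜ ((s ⊕ b) ⊕ x) ⊕ c) ~-refl s₀ s″ b x ⟩
      s₀ ∙ b ∙ x ∙ s″      ∎)
    where
    open ~-Reasoning
    a₀  = back ∣ p ∣ a
    s₀  = back ∣ p ∣ s
    x   = # (0 , e , m , f)
    eq″ = ~-trans (∙-congʳ {x = a} (reflexive (pad-# ∣ p ∣ c))) eq′

  weight : Kind → Count
  weight 𝕓 = 1 , 0 , 0 , 0
  weight 𝕖 = 0 , 1 , 0 , 0
  weight 𝕞 = 0 , 0 , 1 , 0

  -- In the hole the match becomes an abstraction and its type `σ` becomes `A ⇒ σ`; the derivations
  -- for u leave `L` and type the argument. `lam` adds 1 to the first counter where `match` adds 0,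
  -- which pays for the step.
  expand-b : ∀ (L : LCtx n m) p s {u r} → r ⊢ L ⟪ s [ p / rename (under L) u ] ⟫ ∶ σ →
             # (weight 𝕓) ∙ r ⊢ (L ⟪ ƛ p s ⟫) · u ∶ σ
  expand-b {σ = σ} L p s {u} d with frame L Q hole d
    where
    Q : Ty → Res _ → Set
    Q σ′ s′ = ∃[ A ] σ′ ≡ A ⇒ σ × s′ ⊢* u ∶ A
    hole : ∀ {r} → r ⊢ s [ p / rename (under L) u ] ∶ σ → ∃[ σ′ ] ∃[ a ] ∃[ b ] ∃[ s′ ]
           a ⊢ ƛ p s ∶ σ′ × b ⊢ₛ var ∘ under L ∶ s′ × Q σ′ s′ × # (weight 𝕓) ∙ r ~ a ∙ b
    hole {r} (match {e = e} {m} {f} {s = a} {s′ = b} d π l ds eq) with anti-rename* u ds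
    ... | s′ , ds′ , δ =
      _ , a₀ ∙ # (1 , e , m , f) , b , s′ , lam d π ~-refl , δ , (_ , refl , ds′) , (begin
        β ∙ r                       ≈⟨ ∙-congˡ eq ⟩
        β ∙ (a₀ ∙ b ∙ x)            ≈⟨ solve 4 (λ β a b x → β ⊕ ((a ⊕ b) ⊕ x) ⊜ (a ⊕ (β ⊕ x)) ⊕ b) ~-refl β a₀ b x ⟩
        a₀ ∙ (β ∙ x) ∙ b            ≈⟨ ∙-congʳ (∙-congˡ (#-∙ (weight 𝕓) (0 , e , m , f))) ⟩
        a₀ ∙ # (1 , e , m , f) ∙ b  ∎)
      where
      open ~-Reasoning
      β  = # (weight 𝕓)
      a₀ = back ∣ p ∣ a
      x  = # (0 , e , m , f)
  ... | _ , _ , _ , d′ , (A , refl , ds) , eq = app d′ ds eq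

  -- The entry for variable 0 gives the derivations for u, all other entries are variables, and the
  -- unit of weight is the counter of `pat-v`.
  expand-e : ∀ t {u : Term n} {r} → r ⊢ t ⁅ u ⁆ ∶ σ → # (weight 𝕖) ∙ r ⊢ t [ ν / u ] ∶ σ
  expand-e t {u} {r} d with anti-subst t (λ _ → tt) d
  ... | (A ∷ Γ , c) , d′ , cons {s = a} {s′ = b} ds δ eq =
    match d′ (⊩-resp (Contexts.reflexive (sym (front-++ (A ∷ [])))) pat-v) tt ds (begin
      η ∙ r                       ≈⟨ ∙-congˡ eq ⟩
      η ∙ (a ∙ b)                 ≈⟨ ∙-congˡ (∙-congˡ (⊢ₛ-var δ)) ⟩
      η ∙ (a ∙ (Γ , c))           ≈⟨ solve 3 (λ η a b → η ⊕ (a ⊕ b) ⊜ (b ⊕ a) ⊕ η) ~-refl η a (Γ , c) ⟩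
      (Γ , c) ∙ a ∙ η             ≡⟨ cong (λ r → r ∙ a ∙ η) (back-++ (A ∷ [])) ⟨
      back 1 (A ∷ Γ , c) ∙ a ∙ η  ∎)
    where
    open ~-Reasoning
    η = # (weight 𝕖)

  lift-↑ˡ : ∀ k {ρ : Fin m → Fin n} i → lift k ρ (i ↑ˡ m) ≡ i ↑ˡ n
  lift-↑ˡ {m} k i = cong [ _ , _ ]′ (splitAt-↑ˡ k i m)

  lift-↑ʳ : ∀ k {ρ : Fin m → Fin n} i → lift k ρ (k ↑ʳ i) ≡ k ↑ʳ ρ i
  lift-↑ʳ {m} k i = cong [ _ , _ ]′ (splitAt-↑ʳ k m i)

  cast-lift : ∀ k l {ρ : Fin n → Fin m} {i j} → toℕ (lift (k + l) ρ i) ≡ toℕ j →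
              cast (+-assoc k l m) (lift (k + l) ρ i) ≡ j
  cast-lift k l eq = toℕ-injective (trans (toℕ-cast _ _) eq)

  -- The renaming respects three groups of variables: those of the first pattern, those of the
  -- second and the outer ones. Strengthening by k separates the first group from the rest, then
  -- strengthening by l the second from the third.
  ⊢ₛ-lift-assoc : ∀ (Γ₁ : Ctx k) (Γ₂ : Ctx l) {Δ c} {ρ : Fin n → Fin m} {r} →
                  r ⊢ₛ var ∘ cast (+-assoc k l m) ∘ lift (k + l) ρ ∶ ((Γ₁ Vec.++ Γ₂) Vec.++ Δ , c) →
                  Γ₁ ↭ᶜ front k r × Γ₂ ↭ᶜ front l (back k r) × back l (back k r) ⊢ₛ var ∘ ρ ∶ (Δ , c)
  ⊢ₛ-lift-assoc {k} {l} {n} {m} Γ₁ Γ₂ {ρ = ρ} {r} δ with ⊢ₛ-split (Γ₁ Vec.++ Γ₂) δ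
  ... | r₁₂ , r₃ , δ₁₂ , δ₃ , eq with ⊢ₛ-split Γ₁ δ₁₂
  ... | r₁ , r₂ , δ₁ , δ₂ , eq₁₂
    with strengthenₛ (λ x → strengthen-var (x ↑ˡ m)) k (⊢ₛ-ext (λ x → cong var (on₂ x)) δ₂)
       | strengthenₛ (λ x → strengthen (weaken l (var (ρ x)))) k (⊢ₛ-ext (λ x → cong var (on₃ x)) δ₃)
    where
    on₂ : ∀ x → cast (+-assoc k l m) (lift (k + l) ρ ((k ↑ʳ x) ↑ˡ n)) ≡ k ↑ʳ (x ↑ˡ m)
    on₂ x = cast-lift k l (begin
      toℕ (lift (k + l) ρ ((k ↑ʳ x) ↑ˡ n)) ≡⟨ cong toℕ (lift-↑ˡ (k + l) (k ↑ʳ x)) ⟩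
      toℕ ((k ↑ʳ x) ↑ˡ m)                  ≡⟨ toℕ-↑ˡ (k ↑ʳ x) m ⟩
      toℕ (k ↑ʳ x)                         ≡⟨ toℕ-↑ʳ k x ⟩
      k + toℕ x                            ≡⟨ cong (k +_) (toℕ-↑ˡ x m) ⟨
      k + toℕ (x ↑ˡ m)                     ≡⟨ toℕ-↑ʳ k (x ↑ˡ m) ⟨
      toℕ (k ↑ʳ (x ↑ˡ m))                  ∎)
      where open ≡.≡-Reasoning
    on₃ : ∀ x → cast (+-assoc k l m) (lift (k + l) ρ ((k + l) ↑ʳ x)) ≡ k ↑ʳ (l ↑ʳ ρ x)
    on₃ x = cast-lift k l (begin
      toℕ (lift (k + l) ρ ((k + l) ↑ʳ x)) ≡⟨ cong toℕ (lift-↑ʳ (k + l) x) ⟩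
      toℕ ((k + l) ↑ʳ ρ x)                ≡⟨ toℕ-↑ʳ (k + l) (ρ x) ⟩
      k + l + toℕ (ρ x)                   ≡⟨ +-assoc k l _ ⟩
      k + (l + toℕ (ρ x))                 ≡⟨ cong (k +_) (toℕ-↑ʳ l (ρ x)) ⟨
      k + toℕ (l ↑ʳ ρ x)                  ≡⟨ toℕ-↑ʳ k (l ↑ʳ ρ x) ⟨
      toℕ (k ↑ʳ (l ↑ʳ ρ x))               ∎)
      where open ≡.≡-Reasoning
  ... | r₂′ , eq₂ , δ₂′ | r₃′ , eq₃ , δ₃′ with strengthenₛ (λ x → strengthen-var (ρ x)) l δ₃′
  ... | r₃″ , eq₃′ , δ₃″ =
    front-++-pad k eq′ , front-++-pad l eq″ , ⊢ₛ-resp (~-sym (~-trans (back-++-pad l eq″) (identityˡ r₃″))) δ₃″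
    where
    on₁ : ∀ x → cast (+-assoc k l m) (lift (k + l) ρ ((x ↑ˡ l) ↑ˡ n)) ≡ x ↑ˡ (l + m)
    on₁ x = cast-lift k l (begin
      toℕ (lift (k + l) ρ ((x ↑ˡ l) ↑ˡ n)) ≡⟨ cong toℕ (lift-↑ˡ (k + l) (x ↑ˡ l)) ⟩
      toℕ ((x ↑ˡ l) ↑ˡ m)                  ≡⟨ toℕ-↑ˡ (x ↑ˡ l) m ⟩
      toℕ (x ↑ˡ l)                         ≡⟨ toℕ-↑ˡ x l ⟩
      toℕ x                                ≡⟨ toℕ-↑ˡ x (l + m) ⟨
      toℕ (x ↑ˡ (l + m))                   ∎)
      where open ≡.≡-Reasoning
    r₁′ : Res (k + (l + m))
    r₁′ = Γ₁ Vec.++ ∅ , 0 , 0 , 0 , 0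
    eq′ : r ~ r₁′ ∙ pad k (r₂′ ∙ r₃′)
    eq′ = begin
      r                             ≈⟨ eq ⟩
      r₁₂ ∙ r₃                      ≈⟨ ∙-cong eq₁₂ eq₃ ⟩
      r₁ ∙ r₂ ∙ pad k r₃′           ≈⟨ ∙-congʳ (∙-cong (⊢ₛ-↑ˡ (⊢ₛ-ext (λ x → cong var (on₁ x)) δ₁)) eq₂) ⟩
      r₁′ ∙ pad k r₂′ ∙ pad k r₃′   ≈⟨ Resources.assoc r₁′ (pad k r₂′) (pad k r₃′) ⟩
      r₁′ ∙ (pad k r₂′ ∙ pad k r₃′) ≡⟨ cong (r₁′ ∙_) (pad-∙ k r₂′ r₃′) ⟨
      r₁′ ∙ pad k (r₂′ ∙ r₃′)       ∎
      where open ~-Reasoning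
    eq″ = ~-trans (back-++-pad k eq′) (~-trans (identityˡ _) (∙-cong (⊢ₛ-↑ˡ δ₂′) eq₃′))

  -- Here the body t is what leaves `L`, and `Q` keeps its derivation together with the typing of
  -- the pair pattern. The pair stays in the hole, with u₁ strengthened out of the scope of p₂.
  expand-m : ∀ (L : LCtx n m) p₁ p₂ t {u₁ u₂ r} →
             r ⊢ L ⟪ (rename (cast (+-assoc ∣ p₁ ∣ ∣ p₂ ∣ m) ∘ lift ∣ ⟨ p₁ , p₂ ⟩ ∣ (under L)) t
                       [ p₁ / weaken ∣ p₂ ∣ u₁ ]) [ p₂ / u₂ ] ⟫ ∶ σ →
             # (weight 𝕞) ∙ r ⊢ t [ ⟨ p₁ , p₂ ⟩ / L ⟪ ⟨ u₁ , u₂ ⟩ ⟫ ] ∶ σ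
  expand-m {m = m} {σ = σ} L p₁ p₂ t {u₁} {u₂} d with frame L Q hole d
    where
    k₁ = ∣ p₁ ∣
    k₂ = ∣ p₂ ∣
    Q : Ty → Res _ → Set
    Q σ′ s′ = ∃[ s ] ∃[ e ] ∃[ m ] ∃[ f ] s ⊢ t ∶ σ × (front (k₁ + k₂) s ⊩[ e , m , f ] ⟨ p₁ , p₂ ⟩ ∶ σ′ ∷ []) ×
              s′ ≡ back (k₁ + k₂) s ∙ # (0 , e , m , f)
    hole : ∀ {r} →
           r ⊢ (rename (cast (+-assoc k₁ k₂ m) ∘ lift (k₁ + k₂) (under L)) t [ p₁ / weaken k₂ u₁ ]) [ p₂ / u₂ ] ∶ σ →
           ∃[ σ′ ] ∃[ a ] ∃[ b ] ∃[ s′ ]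
           a ⊢ ⟨ u₁ , u₂ ⟩ ∶ σ′ × b ⊢ₛ var ∘ under L ∶ s′ × Q σ′ s′ × # (weight 𝕞) ∙ r ~ a ∙ b
    hole {r} (match {e = e₂} {m₂} {f₂} {s = s₂} {s′ = b₂}
               (match {e = e₁} {m₁} {f₁} {s = s₁} {s′ = b₁} d π₁ _ ds₁ eq₁) π₂ _ ds₂ eq₂)
      with anti-rename t d | strengthen* (strengthen u₁) k₂ ds₁
    ... | (Γ , x) , d′ , δ | b₁′ , b₁-eq , ds₁′ with Vec.splitAt (k₁ + k₂) Γ
    ... | Γ₁₂ , Δ , refl with Vec.splitAt k₁ Γ₁₂
    ... | Γ₁ , Γ₂ , refl with ⊢ₛ-lift-assoc Γ₁ Γ₂ δ
    ... | γ₁ , γ₂ , δ′ =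
      _ , b₁′ ∙ b₂ , s₀ ∙ # c , _ , pair ds₁′ ds₂ ~-refl , ⊢ₛ-∙ δ′ (⊢ₛ-# c) ,
      (_ , _ , _ , _ , d′ , π , cong (_∙ # c) (sym (back-++ (Γ₁ Vec.++ Γ₂)))) , eq
      where
      open ~-Reasoning
      s₀ = back k₂ (back k₁ s₁)
      -- The counters of `pat-×`, whose extra 1 is the weight of the step.
      c  = 0 , e₁ + e₂ , 1 + m₁ + m₂ , f₁ + f₂
      μ  = # (weight 𝕞)
      c₁ = 0 , e₁ , m₁ , f₁
      c₂ = 0 , e₂ , m₂ , f₂
      s₂-eq : pad k₂ ε ∙ s₂ ~ back k₁ s₁ ∙ pad k₂ (b₁′ ∙ # c₁)
      s₂-eq = pad-ε-∙ k₂ (begin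
        s₂                                        ≈⟨ eq₁ ⟩
        back k₁ s₁ ∙ b₁ ∙ # c₁                    ≈⟨ Resources.assoc (back k₁ s₁) b₁ (# c₁) ⟩
        back k₁ s₁ ∙ (b₁ ∙ # c₁)                  ≈⟨ ∙-congˡ (∙-cong b₁-eq (reflexive (sym (pad-# k₂ c₁)))) ⟩
        back k₁ s₁ ∙ (pad k₂ b₁′ ∙ pad k₂ (# c₁)) ≡⟨ cong (back k₁ s₁ ∙_) (pad-∙ k₂ b₁′ (# c₁)) ⟨
        back k₁ s₁ ∙ pad k₂ (b₁′ ∙ # c₁)          ∎)
      π = ≡.subst (λ Γ → Γ ⊩[ _ , _ , _ ] ⟨ p₁ , p₂ ⟩ ∶ _) (sym (front-++ (Γ₁ Vec.++ Γ₂)))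
            (pat-× (⊩-resp (Contexts.sym γ₁) π₁)
                   (⊩-resp (Contexts.trans (front-∙-pad k₂ s₂-eq) (Contexts.sym γ₂)) π₂))
      eq : μ ∙ r ~ b₁′ ∙ b₂ ∙ (s₀ ∙ # c)
      eq = begin
        μ ∙ r                                     ≈⟨ ∙-congˡ eq₂ ⟩
        μ ∙ (back k₂ s₂ ∙ b₂ ∙ # c₂)              ≈⟨ ∙-congˡ (∙-congʳ (∙-congʳ (~-trans (~-sym (identityˡ _)) (back-∙-pad k₂ s₂-eq)))) ⟩
        μ ∙ (s₀ ∙ (b₁′ ∙ # c₁) ∙ b₂ ∙ # c₂)       ≈⟨ solve 6 (λ μ s b₁ c₁ b₂ c₂ → μ ⊕ (((s ⊕ (b₁ ⊕ c₁)) ⊕ b₂) ⊕ c₂) ⊜ (b₁ ⊕ b₂) ⊕ (s ⊕ ((μ ⊕ c₁) ⊕ c₂)))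
                                                       ~-refl μ s₀ b₁′ (# c₁) b₂ (# c₂) ⟩
        b₁′ ∙ b₂ ∙ (s₀ ∙ (μ ∙ # c₁ ∙ # c₂))       ≈⟨ ∙-congˡ (∙-congˡ (~-trans (∙-congʳ (#-∙ (weight 𝕞) c₁)) (#-∙ (weight 𝕞 Counters.∙ c₁) c₂))) ⟩
        b₁′ ∙ b₂ ∙ (s₀ ∙ # c)                     ∎
  ... | σ′ , a , _ , d′ , (s , e , m , f , dₜ , π , refl) , eq =
    match dₜ π (_ , refl) (cons d′ (nil ~-refl) (~-sym (identityʳ a)))
      (~-trans eq (solve 3 (λ a s c → a ⊕ (s ⊕ c) ⊜ (s ⊕ a) ⊕ c) ~-refl a (back ∣ ⟨ p₁ , p₂ ⟩ ∣ s) (# (0 , e , m , f))))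

  #-∙-pad : ∀ k c (s : Res (k + n)) → pad k (# c) ∙ s ~ # c ∙ s ∙ pad k ε
  #-∙-pad k c s = begin
    pad k (# c) ∙ s   ≡⟨ cong (_∙ s) (pad-# k c) ⟩
    # c ∙ s           ≈⟨ identityʳ (# c ∙ s) ⟨
    # c ∙ s ∙ ε       ≡⟨ cong (# c ∙ s ∙_) (pad-# k _) ⟨
    # c ∙ s ∙ pad k ε ∎
    where open ~-Reasoning

  #-∙-back : ∀ k c {r : Res n} {s : Res (k + n)} {a} → r ~ back k s ∙ a → # c ∙ r ~ back k (# c ∙ s) ∙ a
  #-∙-back k c {r} {s} {a} eq = begin
    # c ∙ r                  ≈⟨ ∙-congˡ eq ⟩
    # c ∙ (back k s ∙ a)     ≈⟨ Resources.assoc (# c) (back k s) a ⟨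
    # c ∙ back k s ∙ a       ≈⟨ ∙-congʳ (back-∙-pad k (#-∙-pad k c s)) ⟩
    back k (# c ∙ s) ∙ ε ∙ a ≈⟨ ∙-congʳ (identityʳ (back k (# c ∙ s))) ⟩
    back k (# c ∙ s) ∙ a     ∎
    where open ~-Reasoning

  -- Recursion is on the source term, from which `HeadStep` is computed. The closure rules pass the
  -- weight down to the one premise that types the reducing subterm.
  expand : ∀ (t : Term n) {κ t′ r} → t ⟶ₕ[ κ ] t′ → r ⊢ t′ ∶ σ → # (weight κ) ∙ r ⊢ t ∶ σ
  expand-left : ∀ p t {u : Term n} {κ t′ r} → t ⟶ₕ[ κ ] t′ →
                r ⊢ t′ [ p / u ] ∶ σ → # (weight κ) ∙ r ⊢ t [ p / u ] ∶ σ

  expand (ƛ p t) {κ} (under-ƛ t→) (lam {s = s} d π eq) =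
    lam (expand t t→ d) (⊩-resp (front-∙-pad ∣ p ∣ (#-∙-pad ∣ p ∣ _ s)) π) (#-∙-back ∣ p ∣ (weight κ) eq)
  expand (ƛ p t) {κ} (under-ƛ t→) (lam-p {s = s} d τ eq) =
    lam-p (expand t t→ d) (TightCtx-resp (front-∙-pad ∣ p ∣ (#-∙-pad ∣ p ∣ _ s)) τ) (#-∙-back ∣ p ∣ (weight κ) eq)
  expand (_ · u) (b-step L p s refl) d = expand-b L p s d
  expand (t · u) {κ} (app-left _ t→) (app {s = a} {s′ = b} d ds eq) =
    app (expand t t→ d) ds (~-trans (∙-congˡ eq) (~-sym (Resources.assoc (# (weight κ)) a b)))
  expand (t · u) {κ} (app-left _ t→) (app-p {s = a} d eq) =
    app-p (expand t t→ d) (~-trans (∙-congˡ eq) (~-sym (Resources.assoc (# (weight κ)) a (# _))))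
  expand (t [ ν / u ]) (e-step _) d = expand-e t d
  expand (t [ ν / u ]) (match-left t→) d = expand-left ν t t→ d
  expand (t [ ⟨ p₁ , p₂ ⟩ / _ ]) (m-step L u₁ u₂ refl _) d = expand-m L p₁ p₂ t d
  expand (t [ ⟨ p₁ , p₂ ⟩ / u ]) (match-left t→) d = expand-left ⟨ p₁ , p₂ ⟩ t t→ d
  expand (t [ ⟨ p₁ , p₂ ⟩ / u ]) {κ} {r = r} (match-right _ u→)
         (match {e = e} {m} {f} {s = s} {s′ = b} d π (_ , refl) (cons {s = a} {s′ = a′} d′ (nil a′~ε) eq′) eq) =
    -- The singleton multi-type leaves one derivation for u, so the weight is added exactly once.
    match d π (_ , refl) (cons (expand u u→ d′) (nil a′~ε) ~-refl) (begin
      w ∙ r                     ≈⟨ ∙-congˡ eq ⟩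
      w ∙ (s₀ ∙ b ∙ x)          ≈⟨ ∙-congˡ (∙-congʳ (∙-congˡ eq′)) ⟩
      w ∙ (s₀ ∙ (a ∙ a′) ∙ x)   ≈⟨ solve 5 (λ w s a a′ x → w ⊕ ((s ⊕ (a ⊕ a′)) ⊕ x) ⊜ (s ⊕ ((w ⊕ a) ⊕ a′)) ⊕ x) ~-refl w s₀ a a′ x ⟩
      s₀ ∙ (w ∙ a ∙ a′) ∙ x     ∎)
    where
    open ~-Reasoning
    w  = # (weight κ)
    s₀ = back ∣ ⟨ p₁ , p₂ ⟩ ∣ s
    x  = # (0 , e , m , f)

  expand-left p t {κ = κ} t→ (match {e = e} {m} {f} {s = s} {s′ = b} d π l ds eq) =
    match (expand t t→ d) (⊩-resp (front-∙-pad ∣ p ∣ (#-∙-pad ∣ p ∣ _ s)) π) l ds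
      (~-trans (#-∙-back ∣ p ∣ (weight κ) (~-trans eq (Resources.assoc (back ∣ p ∣ s) b x)))
               (~-sym (Resources.assoc (back ∣ p ∣ (# (weight κ) ∙ s)) b x)))
    where x = # (0 , e , m , f)

  -- Tight completeness along reduction sequences

  complete : ∀ {b e m} {t u : Term n} → _⟶ₕ[_,_,_]_ t b e m u → 𝓜 u →
             ∃[ Γ ] ∃[ τ ] TightCtx Γ × (Γ , b , e , m , size u) ⊢ t ∶ tight τ
  complete done 𝓜u with canonical 𝓜u
  ... | τ , Γ , τΓ , d = Γ , τ , τΓ , d
  complete (b∷ t→s s→u) 𝓜u with complete s→u 𝓜u
  ... | Γ , τ , τΓ , d = Γ , τ , τΓ , ⊢-resp (#-∙ (weight 𝕓) _) (expand _ t→s d)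
  complete (e∷ t→s s→u) 𝓜u with complete s→u 𝓜u
  ... | Γ , τ , τΓ , d = Γ , τ , τΓ , ⊢-resp (#-∙ (weight 𝕖) _) (expand _ t→s d)
  complete (m∷ t→s s→u) 𝓜u with complete s→u 𝓜u
  ... | Γ , τ , τΓ , d = Γ , τ , τΓ , ⊢-resp (#-∙ (weight 𝕞) _) (expand _ t→s d)

  tight-derivation : ∀ {b e m} (t u : Term n) → _⟶ₕ[_,_,_]_ t b e m u → 𝓜 u →
                     ∃[ Γ ] ∃[ τ ] Σ[ Φ ∈ Derivable (Γ , b , e , m , size u) t (tight τ) ] TightDerivation Φ
  tight-derivation t u t→u 𝓜u with complete t→u 𝓜u
  ... | Γ , τ , τΓ , d = Γ , τ , derive d , τΓ , tight τ

theorem3 : ∀ {n b e m : ℕ} (t u : Term n) → t ⟶ₕ[ b , e , m ] u → 𝓜 u →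
    ∃[ Γ ] ∃[ τ ] Σ[ Φ ∈ (Γ ⊢[ b , e , m , size u ] t ∶ tight τ) ] TightDerivation Φ
theorem3 = Completeness.tight-derivation
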